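{- Let $G$ be a triangle-free graph of order $n$. Then $\phi'(G)\le 6^{n/4}$. Furthermore, $\phi'(G)=6^{n/4}$ if and only if $n\equiv 0\pmod 4$ and $G$ is isomorphic to the disjoint union of $n/4$ copies of the cycle $C_4$.
   Context: All graphs are finite, simple, undirected and labeled. A subset of vertices $F$ of a graph $G$ is a dissociation set if the induced subgraph $G[F]$ has maximum degree at most $1$. A maximum dissociation set is a dissociation set of maximum size. $\phi'(G)$ denotes the number of maximum dissociation sets of $G$. -}

module Defs where

open import Data.Nat using (ℕ; zero; suc; _+_; _*_; _≤_; _<_; _≤?_; _<?_; _≡ᵇ_)
open import Data.Nat.DivMod using (_/_; _%_)
open import Data.Bool using (Bool; true; false; _∧_; _∨_)
open import Data.Fin using (Fin; toℕ)
open import Data.Fin.Properties using (all?; any?)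
open import Data.Fin.Subset using (Subset; _∈_; _∩_; ∣_∣; inside; outside)
open import Data.Fin.Subset.Properties using (_∈?_; anySubset?)
open import Data.Vec using (tabulate; _∷_; [])
open import Data.Product using (Σ; ∃; _×_; _,_)
open import Data.Empty using (⊥)
open import Relation.Nullary using (¬_; Dec; yes; no; does)
open import Relation.Nullary.Decidable using (_×-dec_; _→-dec_; ¬?)
open import Relation.Unary using (Pred; Decidable)
open import Relation.Binary.PropositionalEquality using (_≡_; refl)
open import Data.Bool.Properties using (∧-zeroʳ; ∨-comm)
open import Function.Bundles using (_⤖_; Bijection)

record Graph (n : ℕ) : Set where
  field
    adj     : Fin n → Fin n → Bool
    sym     : ∀ u v → adj u v ≡ adj v u
    irrefl  : ∀ v → adj v v ≡ false
open Graph public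

Adj : ∀ {n} → Graph n → Fin n → Fin n → Set
Adj G u v = adj G u v ≡ true

nbhd : ∀ {n} → Graph n → Fin n → Subset n
nbhd G v = tabulate (adj G v)

inducedDegree : ∀ {n} → Graph n → Subset n → Fin n → ℕ
inducedDegree G F v = ∣ nbhd G v ∩ F ∣

IsDissociation : ∀ {n} → Graph n → Subset n → Set
IsDissociation G F = ∀ v → v ∈ F → inducedDegree G F v ≤ 1

IsMaxDissociation : ∀ {n} → Graph n → Subset n → Set
IsMaxDissociation G F =
  IsDissociation G F × (∀ T → IsDissociation G T → ∣ T ∣ ≤ ∣ F ∣)

isDissociation? : ∀ {n} (G : Graph n) → Decidable (IsDissociation G)
isDissociation? G F = all? (λ v → (v ∈? F) →-dec (inducedDegree G F v ≤? 1))

private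
  noBigger? : ∀ {n} (G : Graph n) (F : Subset n) →
              Dec (¬ ∃ λ T → IsDissociation G T × ∣ F ∣ < ∣ T ∣)
  noBigger? G F = ¬? (anySubset? (λ T → isDissociation? G T ×-dec (∣ F ∣ <? ∣ T ∣)))

  ≤-from : ∀ {a b : ℕ} → ¬ (b < a) → a ≤ b
  ≤-from {a} {b} ¬b<a with a ≤? b
  ... | yes p = p
  ... | no ¬p = Data.Empty.⊥-elim (¬b<a (Data.Nat.Properties.≰⇒> ¬p))
    where import Data.Empty; import Data.Nat.Properties

isMaxDissociation? : ∀ {n} (G : Graph n) → Decidable (IsMaxDissociation G)
isMaxDissociation? G F with isDissociation? G F | noBigger? G F
... | no ¬d | _ = no λ { (d , _) → ¬d d }
... | yes d | no ¬nb = no λ { (_ , m) → ¬nb λ { (T , dT , lt) →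
        Data.Nat.Properties.<⇒≱ lt (m T dT) } }
  where import Data.Nat.Properties
... | yes d | yes nb = yes (d , λ T dT → ≤-from λ lt → nb (T , dT , lt))

countSubsets : ∀ {n ℓ} {P : Pred (Subset n) ℓ} → Decidable P → ℕ
countSubsets {zero}  P? = if does (P? []) then 1 else 0
  where open import Data.Bool using (if_then_else_)
countSubsets {suc n} P? =
  countSubsets (λ T → P? (inside ∷ T)) + countSubsets (λ T → P? (outside ∷ T))

φ′ : ∀ {n} → Graph n → ℕ
φ′ G = countSubsets (isMaxDissociation? G)

TriangleFree : ∀ {n} → Graph n → Set
TriangleFree G = ¬ (∃ λ u → ∃ λ v → ∃ λ w → Adj G u v × Adj G v w × Adj G u w)

_≅_ : ∀ {n m} → Graph n → Graph m → Set
_≅_ {n} {m} G H = Σ (Fin n ⤖ Fin m) λ f →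
  ∀ u v → adj G u v ≡ adj H (Bijection.to f u) (Bijection.to f v)

-- the disjoint union of k copies of the 4-cycle C4, on vertex set Fin (4 * k):
-- vertex i lies in copy i / 4 at position i % 4 of the cycle 0-1-2-3-0
private
  ≡ᵇ-sym : ∀ a b → (a ≡ᵇ b) ≡ (b ≡ᵇ a)
  ≡ᵇ-sym zero zero = refl
  ≡ᵇ-sym zero (suc b) = refl
  ≡ᵇ-sym (suc a) zero = refl
  ≡ᵇ-sym (suc a) (suc b) = ≡ᵇ-sym a b

  ≡ᵇ-suc : ∀ a → (a ≡ᵇ suc a) ≡ false
  ≡ᵇ-suc zero = refl
  ≡ᵇ-suc (suc a) = ≡ᵇ-suc a

  step : ℕ → ℕ → Bool
  step x y = (y ≡ᵇ suc x) ∨ ((x ≡ᵇ 3) ∧ (y ≡ᵇ 0))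

  step-irr : ∀ x → step x x ≡ false
  step-irr zero = refl
  step-irr (suc x) rewrite ≡ᵇ-suc (suc x) = ∧-zeroʳ (x ≡ᵇ 2)

  c4adj : ℕ → ℕ → Bool
  c4adj a b = (a / 4 ≡ᵇ b / 4) ∧ (step (a % 4) (b % 4) ∨ step (b % 4) (a % 4))

  c4sym : ∀ a b → c4adj a b ≡ c4adj b a
  c4sym a b rewrite ≡ᵇ-sym (a / 4) (b / 4)
    | ∨-comm (step (a % 4) (b % 4)) (step (b % 4) (a % 4)) = refl

  c4irr : ∀ a → c4adj a a ≡ false
  c4irr a rewrite step-irr (a % 4) = ∧-zeroʳ (a / 4 ≡ᵇ a / 4)

C4s : (k : ℕ) → Graph (4 * k)
C4s k = record
  { adj    = λ u v → c4adj (toℕ u) (toℕ v)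
  ; sym    = λ u v → c4sym (toℕ u) (toℕ v)
  ; irrefl = λ v → c4irr (toℕ v)
  }

{-# OPTIONS --safe #-}
module Submission where

-- Work inside vertex sets U, with φ U the number of maximum dissociation sets of G[U], and put
-- α = 6^(1/4). If F is maximum in U and F meets R in a fixed set I with N(I) ∩ U ⊆ R, then F ─ R
-- is maximum in U ─ R; so covering the possible F by such patterns (R , I) bounds φ U by the sum
-- of the φ (U ─ R). By induction each summand is at most α^(|U| - |R|), and the sum of the α^(-|R|)
-- is below 1 as soon as U has a vertex of degree other than 2: branch on that vertex v (deleted,
-- isolated in F, or matched in F), exploiting a leaf created by deleting v if a neighbour has
-- degree 2, and branching a second time if everything around v is cubic. If all degrees are 2,
-- looking at five consecutive vertices of a cycle other than C₄ again gives a sum below 1, while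
-- a component C₄ contributes a factor of exactly 6 = α⁴.

open import Defs
open import Level using (0ℓ)
open import Data.Nat hiding (∣_-_∣; _≟_)
import Data.Nat as ℕ
open import Data.Nat.Properties hiding (_≟_; suc-injective)
open import Data.Nat.DivMod using (m/n≡1+[m∸n]/n)
open import Data.Nat.Induction using (<-wellFounded)
open import Data.Nat.Tactic.RingSolver using (solve-∀)
open import Data.Bool using (Bool; true; false; T; _∧_; _∨_)
import Data.Bool as Bool
open import Data.Bool.Properties using (¬-not)
open import Data.Empty using (⊥-elim) renaming (⊥ to Absurd)
open import Data.Fin using (Fin; zero; suc; toℕ; fromℕ<; _≟_)
open import Data.Fin.Patterns using (0F; 1F; 2F; 3F; 4F; 5F)
open import Data.Fin.Properties using (any?; all?; suc-injective; toℕ-injective; toℕ<n; toℕ-fromℕ<; fromℕ<-injective)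
open import Data.Fin.Subset using (Subset; Nonempty; _∈_; _∉_; _⊆_; _∩_; _∪_; _─_; _-_; ∣_∣; inside; outside; ⁅_⁆; ⊤; ⊥)
open import Data.Fin.Subset.Properties
open import Data.List using (List; []; _∷_; _++_; length)
open import Data.List.Membership.Propositional using () renaming (_∈_ to _∈ₗ_)
open import Data.List.Relation.Unary.Any as Any using (Any; here; there)
import Data.List.Relation.Unary.Any.Properties as Any
open import Data.List.Relation.Unary.All as All using (All; []; _∷_)
import Data.List.Relation.Unary.All.Properties as All
open import Data.List.Relation.Unary.Unique.Propositional using (Unique; []; _∷_)
open import Data.Product using (Σ; ∃; _×_; _,_; proj₁; proj₂)
open import Data.Sum as Sum using (_⊎_; inj₁; inj₂; [_,_]′)
open import Data.Unit using (tt)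
open import Data.Vec using ([]; _∷_; here; there; lookup; tabulate)
import Data.Vec.Properties as Vec
open import Data.Vec.Properties using (lookup∘tabulate; []=⇒lookup; lookup⇒[]=; ≡-dec)
open import Function using (_∘_; id)
open import Function.Bundles using (_⇔_; mk⇔; Equivalence; Bijection; mk⤖)
open import Induction.WellFounded using (Acc; acc)
open import Relation.Nullary using (¬_; Dec; yes; no; does; contradiction)
open import Relation.Nullary.Decidable using (map′; toWitness; toWitnessFalse; _×-dec_; _⊎-dec_; _→-dec_; ¬?)
open import Relation.Unary using (Pred; Decidable)
open import Relation.Binary.PropositionalEquality using (_≡_; _≢_; refl; trans; cong; cong₂; subst; subst₂) renaming (sym to ≡-sym)

-- Bounds of the form x ≤ c · 6^(m/4)

-- Since `α` is irrational, every inequality compares fourth powers of naturals, and the powers of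
-- `α` enter as integer weights rounded up. The case analysis is shaped by how narrowly a single
-- branching fails. At a vertex of degree `d` whose neighbours have degree at least `e`, the total
-- is `α⁻¹ + α^(-d-1) + d·α^(-d-e)`. This is about 0.92 for `d = 5`, `e = 2`, but 1.02 for `d = 4`,
-- `e = 2`, and 1.01 for `d = e = 3`; for `d = 3`, `e = 2` it is 1.13, and for `d = e = 2` it is
-- 1.23. In degrees 3 and 4 the gain has to come from the first term: a vertex set containing a leaf
-- has a ratio well below 1, and the sharper this ratio, the more cases close. In degree 2 the
-- equality attained by C₄ rules out any argument too local to tell C₄ from a longer cycle. The
-- equality case needs no second pass, because each branching total is strictly below 1 and only C₄
-- components are tight.

^-distribʳ-* : ∀ k a b → (a * b) ^ k ≡ a ^ k * b ^ k
^-distribʳ-* zero a b = refl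
^-distribʳ-* (suc k) a b = trans (cong (a * b *_) (^-distribʳ-* k a b)) (interchange a b (a ^ k) (b ^ k))
  where
  interchange : ∀ a b c d → a * b * (c * d) ≡ a * c * (b * d)
  interchange = solve-∀

^4-distrib-* : ∀ a b → (a * b) ^ 4 ≡ a ^ 4 * b ^ 4
^4-distrib-* = ^-distribʳ-* 4

-- The mediant of `a / w` and `b / v` is at most the larger one, here `b / v`, so `q` alone gives
-- the claim after multiplying by `v ^ 4`. If `v` is zero, then `q` forces `b` to be zero and `p` is
-- the claim. This adds bounds by `N^(1/4)` without any root.
minkowski⁴-ordered : ∀ {a b w v} N → a ^ 4 ≤ w ^ 4 * N → b ^ 4 ≤ v ^ 4 * N →
                     a * v ≤ b * w → (a + b) ^ 4 ≤ (w + v) ^ 4 * N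
minkowski⁴-ordered {a} {b} {w} {zero} N p q _
  rewrite m^n≡0⇒m≡0 b 4 (n≤0⇒n≡0 q) | +-identityʳ a | +-identityʳ w = p
minkowski⁴-ordered {a} {b} {w} {v@(suc _)} N p q le =
  *-cancelʳ-≤ ((a + b) ^ 4) ((w + v) ^ 4 * N) (v ^ 4) {{m^n≢0 v 4}} (begin
    (a + b) ^ 4 * v ^ 4      ≡⟨ ^4-distrib-* (a + b) v ⟨
    ((a + b) * v) ^ 4        ≤⟨ ^-monoˡ-≤ 4 av+bv≤ ⟩
    ((w + v) * b) ^ 4        ≡⟨ ^4-distrib-* (w + v) b ⟩
    (w + v) ^ 4 * b ^ 4      ≤⟨ *-monoʳ-≤ ((w + v) ^ 4) q ⟩
    (w + v) ^ 4 * (v ^ 4 * N) ≡⟨ reassoc ((w + v) ^ 4) (v ^ 4) N ⟩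
    (w + v) ^ 4 * N * v ^ 4  ∎)
  where
  open ≤-Reasoning
  reassoc : ∀ x y z → x * (y * z) ≡ x * z * y
  reassoc = solve-∀
  av+bv≤ : (a + b) * v ≤ (w + v) * b
  av+bv≤ = begin
    (a + b) * v   ≡⟨ *-distribʳ-+ v a b ⟩
    a * v + b * v ≤⟨ +-monoˡ-≤ (b * v) le ⟩
    b * w + b * v ≡⟨ *-distribˡ-+ b w v ⟨
    b * (w + v)   ≡⟨ *-comm b (w + v) ⟩
    (w + v) * b   ∎

minkowski⁴ : ∀ {a b w v} N → a ^ 4 ≤ w ^ 4 * N → b ^ 4 ≤ v ^ 4 * N →
             (a + b) ^ 4 ≤ (w + v) ^ 4 * N
minkowski⁴ {a} {b} {w} {v} N p q with ≤-total (a * v) (b * w)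
... | inj₁ le = minkowski⁴-ordered {a} {b} {w} {v} N p q le
... | inj₂ ge = subst (λ z → z ^ 4 ≤ (w + v) ^ 4 * N) (+-comm b a)
    (subst (λ z → (b + a) ^ 4 ≤ z ^ 4 * N) (+-comm v w)
      (minkowski⁴-ordered {b} {a} {v} {w} N q p ge))

-- Integer form of x ≤ (w / D) · N^(1/4).
record Bound (D N x w : ℕ) : Set where
  constructor bound
  field fourth-powers : (D * x) ^ 4 ≤ w ^ 4 * N

bound-+ : ∀ {D N x y w v} → Bound D N x w → Bound D N y v → Bound D N (x + y) (w + v)
bound-+ {D} {N} {x} {y} {w} {v} (bound p) (bound q) =
  bound (subst (λ z → z ^ 4 ≤ (w + v) ^ 4 * N) (≡-sym (*-distribˡ-+ D x y))
    (minkowski⁴ {D * x} {D * y} {w} {v} N p q))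

bound-mono : ∀ {D N x y w v} → x ≤ y → w ≤ v → Bound D N y w → Bound D N x v
bound-mono {D} {N} x≤y w≤v (bound p) =
  bound (≤-trans (^-monoˡ-≤ 4 (*-monoʳ-≤ D x≤y)) (≤-trans p (*-monoˡ-≤ N (^-monoˡ-≤ 4 w≤v))))

bound-0 : ∀ {D N w} → Bound D N 0 w
bound-0 {D} {N} {w} = bound (subst (λ z → z ^ 4 ≤ w ^ 4 * N) (≡-sym (*-zeroʳ D)) z≤n)

-- In terms of roots, `D·E·x ≤ D·c·N′^(1/4) ≤ E·w·(M·N′)^(1/4)`, and `E` cancels. With `M = 6 ^ k`
-- this turns a loss of `k` vertices into a weight; with `M = 1` it only changes the denominator.
bound-rescale : ∀ {D E N N′ x c w} .{{_ : NonZero E}} M → Bound E N′ x c → M * N′ ≤ N →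
                (D * c) ^ 4 ≤ (E * w) ^ 4 * M → Bound D N x w
bound-rescale {D} {E} {N} {N′} {x} {c} {w} M (bound p) le q = bound
  (*-cancelʳ-≤ ((D * x) ^ 4) (w ^ 4 * N) (E ^ 4) {{m^n≢0 E 4}} (begin
    (D * x) ^ 4 * E ^ 4          ≡⟨ swap D x E ⟩
    D ^ 4 * (E * x) ^ 4          ≤⟨ *-monoʳ-≤ (D ^ 4) p ⟩
    D ^ 4 * (c ^ 4 * N′)         ≡⟨ *-assoc (D ^ 4) (c ^ 4) N′ ⟨
    D ^ 4 * c ^ 4 * N′           ≡⟨ cong (_* N′) (^4-distrib-* D c) ⟨
    (D * c) ^ 4 * N′             ≤⟨ *-monoˡ-≤ N′ q ⟩
    (E * w) ^ 4 * M * N′         ≡⟨ *-assoc ((E * w) ^ 4) M N′ ⟩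
    (E * w) ^ 4 * (M * N′)       ≤⟨ *-monoʳ-≤ ((E * w) ^ 4) le ⟩
    (E * w) ^ 4 * N              ≡⟨ swap′ E w N ⟩
    w ^ 4 * N * E ^ 4            ∎))
  where
  open ≤-Reasoning
  rearrange : ∀ d x e → d * x * e ≡ d * (e * x)
  rearrange = solve-∀
  rearrange′ : ∀ e w n → e * w * n ≡ w * n * e
  rearrange′ = solve-∀
  swap : ∀ d x e → (d * x) ^ 4 * e ^ 4 ≡ d ^ 4 * (e * x) ^ 4
  swap d x e rewrite ^4-distrib-* d x | ^4-distrib-* e x = rearrange (d ^ 4) (x ^ 4) (e ^ 4)
  swap′ : ∀ e w n → (e * w) ^ 4 * n ≡ w ^ 4 * n * e ^ 4
  swap′ e w n rewrite ^4-distrib-* e w = rearrange′ (e ^ 4) (w ^ 4) n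

-- Integer form of c / E ≤ (w / D) · 6^(k/4): the bound c / E for a graph with k vertices fewer
-- counts as w / D.
record Weight (D c E w k : ℕ) : Set where
  constructor weight
  field fourth-powers : (D * c) ^ 4 ≤ (E * w) ^ 4 * 6 ^ k

-- For literal arguments the implicit `T` argument reduces to the unit type and is filled in by the
-- type checker, so every numerical weight is verified by evaluation.
computed : ∀ {D c E w k} {_ : T ((D * c) ^ 4 ≤ᵇ (E * w) ^ 4 * 6 ^ k)} → Weight D c E w k
computed {D} {c} {E} {w} {k} {t} = weight (≤ᵇ⇒≤ ((D * c) ^ 4) ((E * w) ^ 4 * 6 ^ k) t)

bound-shift : ∀ {D E m m′ x c w} .{{_ : NonZero E}} k → Bound E (6 ^ m′) x c → m′ + k ≤ m →
              Weight D c E w k → Bound D (6 ^ m) x w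
bound-shift {m = m} {m′} k p le (weight q) = bound-rescale (6 ^ k) p (begin
    6 ^ k * 6 ^ m′ ≡⟨ ^-distribˡ-+-* 6 k m′ ⟨
    6 ^ (k + m′)   ≡⟨ cong (6 ^_) (+-comm k m′) ⟩
    6 ^ (m′ + k)   ≤⟨ ^-monoʳ-≤ 6 le ⟩
    6 ^ m          ∎) q
  where open ≤-Reasoning

bound-cancel : ∀ {D N x w} d .{{_ : NonZero D}} .{{_ : NonZero d}} →
               Bound (D * d) N x (d * w) → Bound D N x w
bound-cancel {D} {N} {x} {w} d p =
  bound-rescale {{m*n≢0 D d}} 1 p (≤-reflexive (+-identityʳ N))
    (≤-reflexive (trans (cong (_^ 4) (≡-sym (*-assoc D d w))) (≡-sym (*-identityʳ _))))

bound-strict : ∀ {D N x w} .{{_ : NonZero N}} → w < D → Bound D N x w → x ^ 4 < N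
bound-strict {D} {N} {x} {w} w<D (bound p) = *-cancelˡ-< (D ^ 4) (x ^ 4) N (begin-strict
    D ^ 4 * x ^ 4 ≡⟨ ^4-distrib-* D x ⟨
    (D * x) ^ 4   ≤⟨ p ⟩
    w ^ 4 * N     <⟨ *-monoˡ-< N (^-monoˡ-< 4 w<D) ⟩
    D ^ 4 * N     ∎)
  where open ≤-Reasoning

-- (1 + 1/j)⁴ ≤ (3/2)⁴ < 6 for j ≥ 2.
^4-growth : ∀ {j} S W m r → 2 ≤ j → S * j ^ 4 ≤ W * 6 ^ m → S * (r + j) ^ 4 ≤ W * 6 ^ (r + m)
^4-growth S W m zero 2≤j p = p
^4-growth {j} S W m (suc r) 2≤j p = *-cancelˡ-≤ 16 (begin
    16 * (S * (1 + (r + j)) ^ 4)  ≡⟨ swap 16 S ((1 + (r + j)) ^ 4) ⟩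
    S * (16 * (1 + (r + j)) ^ 4)  ≡⟨ cong (S *_) (^4-distrib-* 2 (1 + (r + j))) ⟨
    S * (2 * (1 + (r + j))) ^ 4   ≤⟨ *-monoʳ-≤ S (^-monoˡ-≤ 4 le) ⟩
    S * (3 * (r + j)) ^ 4         ≡⟨ cong (S *_) (^4-distrib-* 3 (r + j)) ⟩
    S * (81 * (r + j) ^ 4)        ≡⟨ swap S 81 ((r + j) ^ 4) ⟩
    -- `81 = 3 ^ 4` and `96 = 6 · 2 ^ 4`.
    81 * (S * (r + j) ^ 4)        ≤⟨ *-mono-≤ (≤ᵇ⇒≤ 81 96 tt) (^4-growth S W m r 2≤j p) ⟩
    96 * (W * 6 ^ (r + m))        ≡⟨ reassoc W (6 ^ (r + m)) ⟩
    16 * (W * (6 * 6 ^ (r + m)))  ∎)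
  where
  open ≤-Reasoning
  swap : ∀ a b c → a * (b * c) ≡ b * (a * c)
  swap = solve-∀
  reassoc : ∀ w z → 96 * (w * z) ≡ 16 * (w * (6 * z))
  reassoc = solve-∀
  le : 2 * (1 + (r + j)) ≤ 3 * (r + j)
  le = begin
    2 * (1 + (r + j))     ≡⟨ *-distribˡ-+ 2 1 (r + j) ⟩
    2 + 2 * (r + j)       ≤⟨ +-monoˡ-≤ (2 * (r + j)) (≤-trans 2≤j (m≤n+m j r)) ⟩
    r + j + 2 * (r + j)   ≡⟨⟩
    3 * (r + j)           ∎

-- Counting subsets: unions, disjoint unions and injections

count-mono : ∀ {n} {P Q : Pred (Subset n) 0ℓ} (P? : Decidable P) (Q? : Decidable Q) →
             (∀ F → P F → Q F) → countSubsets P? ≤ countSubsets Q?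
count-mono {zero} P? Q? f with P? [] | Q? []
... | yes p | yes q = ≤-refl
... | yes p | no ¬q = contradiction (f [] p) ¬q
... | no ¬p | _ = z≤n
count-mono {suc n} P? Q? f =
  +-mono-≤ (count-mono _ _ (f ∘ (inside ∷_))) (count-mono _ _ (f ∘ (outside ∷_)))

+-interchange : ∀ a b c d → a + b + (c + d) ≡ a + c + (b + d)
+-interchange = solve-∀

count-⊎ : ∀ {n} {P Q R : Pred (Subset n) 0ℓ} (P? : Decidable P) (Q? : Decidable Q) (R? : Decidable R) →
          (∀ F → P F → Q F ⊎ R F) → countSubsets P? ≤ countSubsets Q? + countSubsets R?
count-⊎ {zero} P? Q? R? f with P? [] | Q? [] | R? []
... | no ¬p | _ | _ = z≤n
... | yes p | yes q | _ = s≤s z≤n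
... | yes p | no ¬q | yes r = ≤-refl
... | yes p | no ¬q | no ¬r = contradiction (f [] p) [ ¬q , ¬r ]′
count-⊎ {suc n} P? Q? R? f = begin
  countSubsets P₁ + countSubsets P₂
    ≤⟨ +-mono-≤ (count-⊎ P₁ Q₁ R₁ (f ∘ (inside ∷_))) (count-⊎ P₂ Q₂ R₂ (f ∘ (outside ∷_))) ⟩
  countSubsets Q₁ + countSubsets R₁ + (countSubsets Q₂ + countSubsets R₂)
    ≡⟨ +-interchange (countSubsets Q₁) (countSubsets R₁) (countSubsets Q₂) (countSubsets R₂) ⟩
  countSubsets Q₁ + countSubsets Q₂ + (countSubsets R₁ + countSubsets R₂)     ∎
  where
  open ≤-Reasoning
  P₁ = P? ∘ (inside ∷_)
  P₂ = P? ∘ (outside ∷_)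
  Q₁ = Q? ∘ (inside ∷_)
  Q₂ = Q? ∘ (outside ∷_)
  R₁ = R? ∘ (inside ∷_)
  R₂ = R? ∘ (outside ∷_)

count-disjoint : ∀ {n} {P Q R : Pred (Subset n) 0ℓ} (P? : Decidable P) (Q? : Decidable Q) (R? : Decidable R) →
                 (∀ F → Q F ⊎ R F → P F) → (∀ F → Q F → ¬ R F) → countSubsets Q? + countSubsets R? ≤ countSubsets P?
count-disjoint {zero} P? Q? R? f d with P? [] | Q? [] | R? []
... | _ | yes q | yes r = contradiction r (d [] q)
... | yes p | yes q | no ¬r = ≤-refl
... | no ¬p | yes q | no ¬r = contradiction (f [] (inj₁ q)) ¬p
... | yes p | no ¬q | yes r = ≤-refl
... | no ¬p | no ¬q | yes r = contradiction (f [] (inj₂ r)) ¬p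
... | _ | no ¬q | no ¬r = z≤n
count-disjoint {suc n} P? Q? R? f d = begin
  countSubsets Q₁ + countSubsets Q₂ + (countSubsets R₁ + countSubsets R₂)
    ≡⟨ +-interchange (countSubsets Q₁) (countSubsets Q₂) (countSubsets R₁) (countSubsets R₂) ⟩
  countSubsets Q₁ + countSubsets R₁ + (countSubsets Q₂ + countSubsets R₂)
    ≤⟨ +-mono-≤ (count-disjoint P₁ Q₁ R₁ (f ∘ (inside ∷_)) (d ∘ (inside ∷_)))
                (count-disjoint P₂ Q₂ R₂ (f ∘ (outside ∷_)) (d ∘ (outside ∷_))) ⟩
  countSubsets P₁ + countSubsets P₂                             ∎
  where
  open ≤-Reasoning
  P₁ = P? ∘ (inside ∷_)
  P₂ = P? ∘ (outside ∷_)
  Q₁ = Q? ∘ (inside ∷_)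
  Q₂ = Q? ∘ (outside ∷_)
  R₁ = R? ∘ (inside ∷_)
  R₂ = R? ∘ (outside ∷_)

count-∅ : ∀ {n} {P : Pred (Subset n) 0ℓ} (P? : Decidable P) → (∀ F → ¬ P F) → countSubsets P? ≡ 0
count-∅ {zero} P? f with P? []
... | yes p = contradiction p (f [])
... | no _ = refl
count-∅ {suc n} P? f = cong₂ _+_ (count-∅ _ (f ∘ (inside ∷_))) (count-∅ _ (f ∘ (outside ∷_)))

Agrees : ∀ {n} → Subset n → Subset n → Subset n → Set
Agrees R I F = ∀ v → v ∈ R → (v ∈ F ⇔ v ∈ I)

private
  agrees-tail : ∀ {n r i f} {R I F : Subset n} → Agrees (r ∷ R) (i ∷ I) (f ∷ F) → Agrees R I F
  agrees-tail A v v∈R = mk⇔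
    (λ v∈F → drop (Equivalence.to (A (suc v) (there v∈R)) (there v∈F)))
    (λ v∈I → drop (Equivalence.from (A (suc v) (there v∈R)) (there v∈I)))
    where
    drop : ∀ {n s} {S : Subset n} {v} → suc v ∈ (s ∷ S) → v ∈ S
    drop (there p) = p

-- The map taking `F` to `F ─ R` is injective on the sets with prescribed trace on `R`. In the
-- induction a coordinate in `R` leaves only one branch of the count of `P`, and that branch lands
-- in the `outside` branch of `Q`.
count-restrict : ∀ {n} (R I : Subset n) {P Q : Pred (Subset n) 0ℓ} (P? : Decidable P) (Q? : Decidable Q) →
                 (∀ F → P F → Agrees R I F) → (∀ F → P F → Q (F ─ R)) → countSubsets P? ≤ countSubsets Q?
count-restrict [] [] P? Q? a f = count-mono P? Q? λ { [] → f [] }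
count-restrict (outside ∷ R) (i ∷ I) P? Q? a f = +-mono-≤
  (count-restrict R I _ _ (λ F p → agrees-tail (a _ p)) (f ∘ (inside ∷_)))
  (count-restrict R I _ _ (λ F p → agrees-tail (a _ p)) (f ∘ (outside ∷_)))
count-restrict (inside ∷ R) (inside ∷ I) P? Q? a f = begin
  countSubsets P₁ + countSubsets (P? ∘ (outside ∷_))
    ≡⟨ cong (countSubsets P₁ +_) (count-∅ (P? ∘ (outside ∷_)) λ F p → case (Equivalence.from (a _ p zero here) here)) ⟩
  countSubsets P₁ + 0                         ≡⟨ +-identityʳ _ ⟩
  countSubsets P₁                             ≤⟨ count-restrict R I P₁ Q₂ (λ F p → agrees-tail (a _ p)) (f ∘ (inside ∷_)) ⟩
  countSubsets Q₂                             ≤⟨ m≤n+m _ _ ⟩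
  countSubsets (Q? ∘ (inside ∷_)) + countSubsets Q₂  ∎
  where
  open ≤-Reasoning
  P₁ = P? ∘ (inside ∷_)
  Q₂ = Q? ∘ (outside ∷_)
  case : ∀ {n} {S : Subset n} → ¬ (zero ∈ (outside ∷ S))
  case ()
count-restrict (inside ∷ R) (outside ∷ I) P? Q? a f = begin
  countSubsets (P? ∘ (inside ∷_)) + countSubsets P₂
    ≡⟨ cong (_+ countSubsets P₂) (count-∅ (P? ∘ (inside ∷_)) λ F p → case (Equivalence.to (a _ p zero here) here)) ⟩
  countSubsets P₂                             ≤⟨ count-restrict R I P₂ Q₂ (λ F p → agrees-tail (a _ p)) (f ∘ (outside ∷_)) ⟩
  countSubsets Q₂                             ≤⟨ m≤n+m _ _ ⟩
  countSubsets (Q? ∘ (inside ∷_)) + countSubsets Q₂  ∎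
  where
  open ≤-Reasoning
  P₂ = P? ∘ (outside ∷_)
  Q₂ = Q? ∘ (outside ∷_)
  case : ∀ {n} {S : Subset n} → ¬ (zero ∈ (outside ∷ S))
  case ()

-- The reverse injection: `T` can be recovered from `T ∪ I` when the two are disjoint.
count-extend : ∀ {n} (I : Subset n) {P Q : Pred (Subset n) 0ℓ} (P? : Decidable P) (Q? : Decidable Q) →
               (∀ T v → Q T → v ∈ I → v ∉ T) → (∀ T → Q T → P (T ∪ I)) → countSubsets Q? ≤ countSubsets P?
count-extend [] P? Q? d f = count-mono Q? P? λ { [] → f [] }
count-extend (outside ∷ I) P? Q? d f = +-mono-≤
  (count-extend I _ _ (λ T v q v∈I v∈T → d _ (suc v) q (there v∈I) (there v∈T)) (f ∘ (inside ∷_)))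
  (count-extend I _ _ (λ T v q v∈I v∈T → d _ (suc v) q (there v∈I) (there v∈T)) (f ∘ (outside ∷_)))
count-extend (inside ∷ I) P? Q? d f = begin
  countSubsets (Q? ∘ (inside ∷_)) + countSubsets Q₂  ≡⟨ cong (_+ countSubsets Q₂) (count-∅ (Q? ∘ (inside ∷_)) λ T q → d _ zero q here here) ⟩
  countSubsets Q₂                             ≤⟨ count-extend I P₁ Q₂ (λ T v q v∈I v∈T → d _ (suc v) q (there v∈I) (there v∈T)) (f ∘ (outside ∷_)) ⟩
  countSubsets P₁                             ≤⟨ m≤m+n _ _ ⟩
  countSubsets P₁ + countSubsets (P? ∘ (outside ∷_)) ∎
  where
  open ≤-Reasoning
  P₁ = P? ∘ (inside ∷_)
  Q₂ = Q? ∘ (outside ∷_)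

-- Subsets, and maximum dissociation sets of induced subgraphs

x∉p─q : ∀ {n} {p q : Subset n} {x} → x ∈ p ─ q → x ∉ q
x∉p─q {p = _ ∷ p} {q = inside ∷ q} () here
x∉p─q {p = _ ∷ p} {q = _ ∷ q} (there x∈) (there x∈q) = x∉p─q x∈ x∈q

∣p∣≡∣p─q∣+∣p∩q∣ : ∀ {n} (p q : Subset n) → ∣ p ∣ ≡ ∣ p ─ q ∣ + ∣ p ∩ q ∣
∣p∣≡∣p─q∣+∣p∩q∣ [] [] = refl
∣p∣≡∣p─q∣+∣p∩q∣ (inside ∷ p) (inside ∷ q) = trans (cong suc (∣p∣≡∣p─q∣+∣p∩q∣ p q)) (≡-sym (+-suc _ _))
∣p∣≡∣p─q∣+∣p∩q∣ (inside ∷ p) (outside ∷ q) = cong suc (∣p∣≡∣p─q∣+∣p∩q∣ p q)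
∣p∣≡∣p─q∣+∣p∩q∣ (outside ∷ p) (inside ∷ q) = ∣p∣≡∣p─q∣+∣p∩q∣ p q
∣p∣≡∣p─q∣+∣p∩q∣ (outside ∷ p) (outside ∷ q) = ∣p∣≡∣p─q∣+∣p∩q∣ p q

∣p∣+∣q∣≤ : ∀ {n} {p q r : Subset n} → p ⊆ r → q ⊆ r → (∀ {x} → x ∈ p → x ∉ q) → ∣ p ∣ + ∣ q ∣ ≤ ∣ r ∣
∣p∣+∣q∣≤ {p = p} {q} {r} p⊆r q⊆r dis = begin
  ∣ p ∣ + ∣ q ∣         ≤⟨ +-mono-≤ (p⊆q⇒∣p∣≤∣q∣ λ x∈p → x∈p∧x∉q⇒x∈p─q (p⊆r x∈p) (dis x∈p))
                                    (p⊆q⇒∣p∣≤∣q∣ λ x∈q → x∈p∩q⁺ (q⊆r x∈q , x∈q)) ⟩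
  ∣ r ─ q ∣ + ∣ r ∩ q ∣ ≡⟨ ∣p∣≡∣p─q∣+∣p∩q∣ r q ⟨
  ∣ r ∣                 ∎
  where open ≤-Reasoning

∣p∣+∣q∣+∣r∣≤ : ∀ {n} {p q r s : Subset n} → p ⊆ s → q ⊆ s → r ⊆ s → (∀ {x} → x ∈ p → x ∉ q) →
               (∀ {x} → x ∈ p → x ∉ r) → (∀ {x} → x ∈ q → x ∉ r) → ∣ p ∣ + (∣ q ∣ + ∣ r ∣) ≤ ∣ s ∣
∣p∣+∣q∣+∣r∣≤ {p = p} {q} {r} p⊆ q⊆ r⊆ p-q p-r q-r =
  ≤-trans (+-monoʳ-≤ ∣ p ∣ (∣p∣+∣q∣≤ {r = q ∪ r} (p⊆p∪q r) (q⊆p∪q q r) q-r))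
    (∣p∣+∣q∣≤ p⊆ ([ q⊆ , r⊆ ]′ ∘ x∈p∪q⁻ q r) λ x∈p → [ p-q x∈p , p-r x∈p ]′ ∘ x∈p∪q⁻ q r)

∣p-x∣ : ∀ {n} {p : Subset n} {x} → x ∈ p → ∣ p - x ∣ + 1 ≡ ∣ p ∣
∣p-x∣ {p = p} {x} x∈p = ≡-sym (trans (∣p∣≡∣p─q∣+∣p∩q∣ p ⁅ x ⁆) (cong (∣ p - x ∣ +_) (≤-antisym
  (subst (∣ p ∩ ⁅ x ⁆ ∣ ≤_) (∣⁅x⁆∣≡1 x) (∣p∩q∣≤∣q∣ p ⁅ x ⁆))
  (subst (_≤ ∣ p ∩ ⁅ x ⁆ ∣) (∣⁅x⁆∣≡1 x) (p⊆q⇒∣p∣≤∣q∣ λ y∈ →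
    x∈p∩q⁺ (subst (_∈ p) (≡-sym (x∈⁅y⁆⇒x≡y x y∈)) x∈p , y∈))))))

x∈p-y⇒x∈p : ∀ {n} (p : Subset n) y {x} → x ∈ p - y → x ∈ p
x∈p-y⇒x∈p p y = p─q⊆p p ⁅ y ⁆

x∈p-y⇒x≢y : ∀ {n} (p : Subset n) y {x} → x ∈ p - y → x ≢ y
x∈p-y⇒x≢y p y {x} x∈ refl = x∉p─q {p = p} x∈ (x∈⁅x⁆ x)

∣p∣+length≤ : ∀ {n} {p q : Subset n} (xs : List (Fin n)) → Unique xs → All (_∈ q) xs → All (_∉ p) xs →
              p ⊆ q → ∣ p ∣ + length xs ≤ ∣ q ∣
∣p∣+length≤ {p = p} [] _ _ _ p⊆q = subst (_≤ _) (≡-sym (+-identityʳ ∣ p ∣)) (p⊆q⇒∣p∣≤∣q∣ p⊆q)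
∣p∣+length≤ {p = p} {q} (x ∷ xs) (x∉xs ∷ u) (x∈q ∷ xs⊆q) (x∉p ∷ xs∉p) p⊆q = begin
  ∣ p ∣ + suc (length xs) ≡⟨ +-suc ∣ p ∣ (length xs) ⟩
  suc (∣ p ∣ + length xs) ≡⟨ +-comm 1 (∣ p ∣ + length xs) ⟩
  ∣ p ∣ + length xs + 1   ≤⟨ +-monoˡ-≤ 1 (∣p∣+length≤ {q = q - x} xs u
                               (All.zipWith (λ (y∈q , x≢y) → x∈p∧x≢y⇒x∈p-y y∈q (x≢y ∘ ≡-sym)) (xs⊆q , x∉xs)) xs∉p
                               (λ y∈p → x∈p∧x≢y⇒x∈p-y (p⊆q y∈p) λ { refl → x∉p y∈p })) ⟩
  ∣ q - x ∣ + 1           ≡⟨ ∣p-x∣ x∈q ⟩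
  ∣ q ∣                   ∎
  where open ≤-Reasoning

x∈p⇒1≤∣p∣ : ∀ {n} {p : Subset n} {x} → x ∈ p → 1 ≤ ∣ p ∣
x∈p⇒1≤∣p∣ {p = p} {x} x∈p = subst (_≤ ∣ p ∣) (∣⁅x⁆∣≡1 x)
  (p⊆q⇒∣p∣≤∣q∣ λ y∈ → subst (_∈ p) (≡-sym (x∈⁅y⁆⇒x≡y x y∈)) x∈p)

∣p∣≡0⇒∉ : ∀ {n} {p : Subset n} {x} → ∣ p ∣ ≡ 0 → x ∉ p
∣p∣≡0⇒∉ eq x∈p = contradiction (subst (1 ≤_) eq (x∈p⇒1≤∣p∣ x∈p)) λ ()

unique⇒∣p∣≤1 : ∀ {n} {p : Subset n} → (∀ {x y} → x ∈ p → y ∈ p → x ≡ y) → ∣ p ∣ ≤ 1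
unique⇒∣p∣≤1 {n} {p} u with nonempty? p
... | yes (x , x∈p) = subst (∣ p ∣ ≤_) (∣⁅x⁆∣≡1 x)
  (p⊆q⇒∣p∣≤∣q∣ λ y∈p → subst (_∈ ⁅ x ⁆) (u x∈p y∈p) (x∈⁅x⁆ x))
... | no e rewrite Empty-unique e = subst (_≤ 1) (≡-sym (∣⊥∣≡0 n)) z≤n

∣p∣≤1⇒unique : ∀ {n} {p : Subset n} → ∣ p ∣ ≤ 1 → ∀ {x y} → x ∈ p → y ∈ p → x ≡ y
∣p∣≤1⇒unique {n} {p} le {x} {y} x∈p y∈p with x ≟ y
... | yes eq = eq
... | no x≢y = contradiction
  (subst (λ z → z + 2 ≤ ∣ p ∣) (∣⊥∣≡0 n)
    (∣p∣+length≤ {p = ⊥} (x ∷ y ∷ []) ((x≢y ∷ []) ∷ [] ∷ []) (x∈p ∷ y∈p ∷ []) (∉⊥ ∷ ∉⊥ ∷ []) (⊥-elim ∘ ∉⊥)))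
  (<⇒≱ (s≤s le))

∣p∣≡suc⇒pick : ∀ {n m} {p : Subset n} → ∣ p ∣ ≡ suc m → ∃ λ x → x ∈ p × ∣ p - x ∣ ≡ m
∣p∣≡suc⇒pick {n} {m} {p} eq with nonempty? p
... | yes (x , x∈p) = x , x∈p , +-cancelʳ-≡ 1 _ _ (trans (∣p-x∣ x∈p) (trans eq (+-comm 1 m)))
... | no e = contradiction (trans (≡-sym eq) (trans (cong ∣_∣ (Empty-unique e)) (∣⊥∣≡0 n))) λ ()

∣p-x∣≡ : ∀ {n m} {p : Subset n} {x} → x ∈ p → ∣ p ∣ ≡ suc m → ∣ p - x ∣ ≡ m
∣p-x∣≡ {m = m} x∈p eq = +-cancelʳ-≡ 1 _ _ (trans (∣p-x∣ x∈p) (trans eq (+-comm 1 m)))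

comprehend : ∀ {n} {P : Pred (Fin n) 0ℓ} → Decidable P → Subset n
comprehend P? = tabulate (does ∘ P?)

∈-comprehend⁺ : ∀ {n} {P : Pred (Fin n) 0ℓ} (P? : Decidable P) {x} → P x → x ∈ comprehend P?
∈-comprehend⁺ P? {x} Px = lookup⇒[]= x _ (trans (lookup∘tabulate (does ∘ P?) x) does≡)
  where
  does≡ : does (P? x) ≡ true
  does≡ with P? x
  ... | yes _ = refl
  ... | no ¬p = contradiction Px ¬p

∈-comprehend⁻ : ∀ {n} {P : Pred (Fin n) 0ℓ} (P? : Decidable P) {x} → x ∈ comprehend P? → P x
∈-comprehend⁻ P? {x} x∈ with P? x | trans (≡-sym (lookup∘tabulate (does ∘ P?) x)) ([]=⇒lookup x∈)
... | yes p | _ = p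
... | no _ | ()

module Dissociation {n : ℕ} (G : Graph n) where

  infix 4 _~_
  _~_ : Fin n → Fin n → Set
  u ~ v = Adj G u v

  ~-sym : ∀ {u v} → u ~ v → v ~ u
  ~-sym {u} {v} = trans (sym G v u)

  ~-irrefl : ∀ {v} → ¬ v ~ v
  ~-irrefl {v} v~v = contradiction (trans (≡-sym v~v) (irrefl G v)) λ ()

  ~⇒≢ : ∀ {u v} → u ~ v → u ≢ v
  ~⇒≢ u~v refl = ~-irrefl u~v

  _~?_ : ∀ u v → Dec (u ~ v)
  u ~? v = adj G u v Bool.≟ true

  ∈-nbhd⁺ : ∀ {u v} → u ~ v → v ∈ nbhd G u
  ∈-nbhd⁺ {u} {v} u~v = lookup⇒[]= v _ (trans (lookup∘tabulate (adj G u) v) u~v)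

  ∈-nbhd⁻ : ∀ {u v} → v ∈ nbhd G u → u ~ v
  ∈-nbhd⁻ {u} {v} v∈ = trans (≡-sym (lookup∘tabulate (adj G u) v)) ([]=⇒lookup v∈)

  N : Subset n → Fin n → Subset n
  N U v = nbhd G v ∩ U

  deg : Subset n → Fin n → ℕ
  deg U v = inducedDegree G U v

  ∈N⁺ : ∀ {U u v} → u ~ v → v ∈ U → v ∈ N U u
  ∈N⁺ u~v v∈U = x∈p∩q⁺ (∈-nbhd⁺ u~v , v∈U)

  ∈N⇒~ : ∀ U {u v} → v ∈ N U u → u ~ v
  ∈N⇒~ U {u} v∈ = ∈-nbhd⁻ (proj₁ (x∈p∩q⁻ (nbhd G u) U v∈))

  ∈N⇒∈ : ∀ U {u v} → v ∈ N U u → v ∈ U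
  ∈N⇒∈ U {u} v∈ = proj₂ (x∈p∩q⁻ (nbhd G u) U v∈)

  -- Degree at most 1 phrased as uniqueness of the neighbour within `F`, which spares the case
  -- distinctions below any counting.
  Dis : Pred (Subset n) 0ℓ
  Dis F = ∀ {v x y} → v ∈ F → x ∈ F → y ∈ F → v ~ x → v ~ y → x ≡ y

  dis⇒IsDissociation : ∀ {F} → Dis F → IsDissociation G F
  dis⇒IsDissociation {F} d v v∈F = unique⇒∣p∣≤1 λ x∈ y∈ → d v∈F (∈N⇒∈ F x∈) (∈N⇒∈ F y∈) (∈N⇒~ F x∈) (∈N⇒~ F y∈)

  IsDissociation⇒dis : ∀ {F} → IsDissociation G F → Dis F
  IsDissociation⇒dis d {v} v∈F x∈F y∈F v~x v~y = ∣p∣≤1⇒unique (d v v∈F) (∈N⁺ v~x x∈F) (∈N⁺ v~y y∈F)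

  dis? : Decidable Dis
  dis? F = map′ (λ p → IsDissociation⇒dis p) dis⇒IsDissociation (isDissociation? G F)

  dis-⊆ : ∀ {E F} → E ⊆ F → Dis F → Dis E
  dis-⊆ E⊆F d v∈ x∈ y∈ = d (E⊆F v∈) (E⊆F x∈) (E⊆F y∈)

  dis-∪ : ∀ {E F} → Dis E → Dis F → (∀ {x y} → x ∈ E → y ∈ F → ¬ x ~ y) → Dis (E ∪ F)
  dis-∪ {E} {F} dE dF no-edge v∈ x∈ y∈ v~x v~y
    with x∈p∪q⁻ E F v∈ | x∈p∪q⁻ E F x∈ | x∈p∪q⁻ E F y∈
  ... | inj₁ v∈E | inj₁ x∈E | inj₁ y∈E = dE v∈E x∈E y∈E v~x v~y
  ... | inj₁ v∈E | inj₂ x∈F | _ = contradiction v~x (no-edge v∈E x∈F)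
  ... | inj₁ v∈E | _ | inj₂ y∈F = contradiction v~y (no-edge v∈E y∈F)
  ... | inj₂ v∈F | inj₁ x∈E | _ = contradiction (~-sym v~x) (no-edge x∈E v∈F)
  ... | inj₂ v∈F | _ | inj₁ y∈E = contradiction (~-sym v~y) (no-edge y∈E v∈F)
  ... | inj₂ v∈F | inj₂ x∈F | inj₂ y∈F = dF v∈F x∈F y∈F v~x v~y

  -- For `F ⊆ U` adjacency within `F` is the same in `G` and in `G[U]`. So induced subgraphs are
  -- never built, and the induction runs over the vertex sets of one fixed `G`.
  record MaxIn (U F : Subset n) : Set where
    constructor maxIn
    field
      sub : F ⊆ U
      dis : Dis F
      max : ∀ {T} → T ⊆ U → Dis T → ∣ T ∣ ≤ ∣ F ∣
  open MaxIn public

  maxIn? : ∀ U → Decidable (MaxIn U)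
  maxIn? U F = map′ to from
    ((F ⊆? U) ×-dec dis? F ×-dec ¬? (anySubset? λ T → (T ⊆? U) ×-dec dis? T ×-dec (∣ F ∣ <? ∣ T ∣)))
    where
    Larger : Pred (Subset n) 0ℓ
    Larger T = T ⊆ U × Dis T × ∣ F ∣ < ∣ T ∣
    to : F ⊆ U × Dis F × ¬ ∃ Larger → MaxIn U F
    to (s , d , m) = maxIn s d λ {T} T⊆U dT → ≮⇒≥ λ lt → m (T , T⊆U , dT , lt)
    from : MaxIn U F → F ⊆ U × Dis F × ¬ ∃ Larger
    from M = sub M , dis M , λ (T , T⊆U , dT , lt) → <⇒≱ lt (max M T⊆U dT)

  φ : Subset n → ℕ
  φ U = countSubsets (maxIn? U)

  -- Otherwise `F ∪ ⁅ v ⁆` would be a larger dissociation set: `v` gets at most one neighbour in it,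
  -- and that neighbour had none in `F`. Branchings use this to discard patterns that no maximum set
  -- can have.
  unaddable : ∀ {U F v} → MaxIn U F → v ∈ U → v ∉ F →
            (∀ {x y} → x ∈ F → y ∈ F → v ~ x → v ~ y → x ≡ y) →
            (∀ {x y} → x ∈ F → y ∈ F → v ~ x → ¬ x ~ y) → Absurd
  unaddable {U} {F} {v} M v∈U v∉F uniq iso = <⇒≱ (begin-strict
      ∣ F ∣               <⟨ n<1+n ∣ F ∣ ⟩
      suc ∣ F ∣           ≡⟨ +-comm 1 ∣ F ∣ ⟩
      ∣ F ∣ + 1           ≡⟨ cong (∣ F ∣ +_) (∣⁅x⁆∣≡1 v) ⟨
      ∣ F ∣ + ∣ ⁅ v ⁆ ∣   ≤⟨ ∣p∣+∣q∣≤ (p⊆p∪q ⁅ v ⁆) (q⊆p∪q F ⁅ v ⁆) (λ x∈F x∈v → v∉F (subst (_∈ F) (x∈⁅y⁆⇒x≡y v x∈v) x∈F)) ⟩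
      ∣ F ∪ ⁅ v ⁆ ∣       ∎) (max M T⊆U dT)
    where
    open ≤-Reasoning
    T⊆U : F ∪ ⁅ v ⁆ ⊆ U
    T⊆U x∈ with x∈p∪q⁻ F ⁅ v ⁆ x∈
    ... | inj₁ x∈F = sub M x∈F
    ... | inj₂ x∈v rewrite x∈⁅y⁆⇒x≡y v x∈v = v∈U
    view : ∀ {x} → x ∈ F ∪ ⁅ v ⁆ → x ∈ F ⊎ x ≡ v
    view = Sum.map₂ (x∈⁅y⁆⇒x≡y v) ∘ x∈p∪q⁻ F ⁅ v ⁆
    dT : Dis (F ∪ ⁅ v ⁆)
    dT z∈ x∈ y∈ z~x z~y with view z∈ | view x∈ | view y∈
    ... | inj₁ z∈F | inj₁ x∈F | inj₁ y∈F = dis M z∈F x∈F y∈F z~x z~y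
    ... | inj₁ z∈F | inj₁ x∈F | inj₂ refl = contradiction z~x (iso z∈F x∈F (~-sym z~y))
    ... | inj₁ z∈F | inj₂ refl | inj₁ y∈F = contradiction z~y (iso z∈F y∈F (~-sym z~x))
    ... | inj₁ z∈F | inj₂ refl | inj₂ refl = refl
    ... | inj₂ refl | inj₂ refl | _ = contradiction z~x ~-irrefl
    ... | inj₂ refl | _ | inj₂ refl = contradiction z~y ~-irrefl
    ... | inj₂ refl | inj₁ x∈F | inj₁ y∈F = uniq x∈F y∈F z~x z~y

  -- An exchange argument: if `T` is a dissociation set in `U ─ R`, then so is `T ∪ (F ∩ R)` in `U`,
  -- because `F ∩ R` lies in `I` and the neighbours of `I` in `U` all lie in `R`. Comparing its size
  -- with that of `F` cancels `F ∩ R`.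
  MaxIn-─ : ∀ {U R I F} → (∀ {i w} → i ∈ I → w ∈ U → i ~ w → w ∈ R) → Agrees R I F →
            MaxIn U F → MaxIn (U ─ R) (F ─ R)
  MaxIn-─ {U} {R} {I} {F} closed agrees M = maxIn
    (λ x∈ → x∈p∧x∉q⇒x∈p─q (sub M (p─q⊆p F R x∈)) (x∉p─q x∈))
    (dis-⊆ (p─q⊆p F R) (dis M))
    λ {T} T⊆ dT → +-cancelʳ-≤ (∣ F ∩ R ∣) (∣ T ∣) (∣ F ─ R ∣) (begin
      ∣ T ∣ + ∣ F ∩ R ∣     ≤⟨ ∣p∣+∣q∣≤ (p⊆p∪q (F ∩ R)) (q⊆p∪q T (F ∩ R))
                                 (λ x∈T x∈ → x∉p─q (T⊆ x∈T) (proj₂ (x∈p∩q⁻ F R x∈))) ⟩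
      ∣ T ∪ (F ∩ R) ∣       ≤⟨ max M (λ x∈ → [ p─q⊆p U R ∘ T⊆ , sub M ∘ p∩q⊆p F R ]′ (x∈p∪q⁻ T (F ∩ R) x∈))
                                 (dis-∪ dT (dis-⊆ (p∩q⊆p F R) (dis M)) λ x∈T y∈ x~y →
                                   let (y∈F , y∈R) = x∈p∩q⁻ F R y∈ in
                                   x∉p─q (T⊆ x∈T) (closed (Equivalence.to (agrees _ y∈R) y∈F)
                                     (p─q⊆p U R (T⊆ x∈T)) (~-sym x~y))) ⟩
      ∣ F ∣                 ≡⟨ ∣p∣≡∣p─q∣+∣p∩q∣ F R ⟩
      ∣ F ─ R ∣ + ∣ F ∩ R ∣ ∎)
    where open ≤-Reasoning

  -- Bounding every decidable part of the maximum dissociation sets satisfying A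
  -- dispenses with a decision procedure for A.
  Few : Subset n → Pred (Subset n) 0ℓ → (D M w : ℕ) → Set₁
  Few U A D M w = ∀ {Q : Pred (Subset n) 0ℓ} (Q? : Decidable Q) →
    (∀ {F} → Q F → MaxIn U F × A F) → Bound D M (countSubsets Q?) w

  few⇒bound : ∀ {U A D M w} → (∀ {F} → MaxIn U F → A F) → Few U A D M w → Bound D M (φ U) w
  few⇒bound {U} f few = few (maxIn? U) λ M → M , f M

  few-∅ : ∀ {U A D M w} → (∀ {F} → MaxIn U F → ¬ A F) → Few U A D M w
  few-∅ f Q? h = subst (λ x → Bound _ _ x _)
    (≡-sym (count-∅ Q? λ F q → f (proj₁ (h q)) (proj₂ (h q)))) bound-0

  -- `B` and `C` need not be decidable: each `F` is assigned to the alternative that `f` happens to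
  -- return, and having been assigned to it is decidable.
  few-⊎ : ∀ {U A B C D M w v} → (∀ {F} → MaxIn U F → A F → B F ⊎ C F) →
          Few U B D M w → Few U C D M v → Few U A D M (w + v)
  few-⊎ {B = B} {C} f few-B few-C {Q} Q? h =
    bound-mono (count-⊎ Q? QB? QC? cover) ≤-refl (bound-+ (few-B QB? QB⇒) (few-C QC? QC⇒))
    where
    classify : ∀ F → (Q F × B F) ⊎ ((Q F × C F) ⊎ ¬ Q F)
    classify F with Q? F
    ... | no ¬q = inj₂ (inj₂ ¬q)
    ... | yes q with f (proj₁ (h q)) (proj₂ (h q))
    ...   | inj₁ b = inj₁ (q , b)
    ...   | inj₂ c = inj₂ (inj₁ (q , c))
    QB QC : Pred (Subset n) 0ℓ
    QB F = ∃ λ x → classify F ≡ inj₁ x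
    QC F = ∃ λ x → classify F ≡ inj₂ (inj₁ x)
    QB? : Decidable QB
    QB? F with classify F
    ... | inj₁ x = yes (x , refl)
    ... | inj₂ _ = no λ ()
    QC? : Decidable QC
    QC? F with classify F
    ... | inj₁ _ = no λ ()
    ... | inj₂ (inj₁ x) = yes (x , refl)
    ... | inj₂ (inj₂ _) = no λ ()
    QB⇒ : ∀ {F} → QB F → MaxIn _ F × B F
    QB⇒ ((q , b) , _) = proj₁ (h q) , b
    QC⇒ : ∀ {F} → QC F → MaxIn _ F × C F
    QC⇒ ((q , c) , _) = proj₁ (h q) , c
    cover : ∀ F → Q F → QB F ⊎ QC F
    cover F q with classify F
    ... | inj₁ x = inj₁ (x , refl)
    ... | inj₂ (inj₁ x) = inj₂ (x , refl)
    ... | inj₂ (inj₂ ¬q) = contradiction q ¬q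

  few-mono : ∀ {U A B D M w v} → (∀ {F} → MaxIn U F → A F → B F) → w ≤ v → Few U B D M w → Few U A D M v
  few-mono f le few Q? h = bound-mono ≤-refl le (few Q? λ q → proj₁ (h q) , f (proj₁ (h q)) (proj₂ (h q)))

  few-∃-sum : ∀ {m U D M w} (S : Subset m) (A : Fin m → Pred (Subset n) 0ℓ) → (∀ {u} → u ∈ S → Few U (A u) D M w) →
              Few U (λ F → ∃ λ u → u ∈ S × A u F) D M (∣ S ∣ * w)
  few-∃-sum [] A few = few-∅ λ { _ (() , _) }
  few-∃-sum (inside ∷ S) A few = few-⊎
    (λ { _ (zero , _ , a) → inj₁ a ; _ (suc u , there u∈S , a) → inj₂ (u , u∈S , a) })
    (few here) (few-∃-sum S (A ∘ suc) (few ∘ there))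
  few-∃-sum (outside ∷ S) A few = few-mono
    (λ { _ (suc u , there u∈S , a) → u , u∈S , a }) ≤-refl
    (few-∃-sum S (A ∘ suc) (few ∘ there))

  -- Bounding each term with denominator `D * d` and cancelling `d` afterwards means that the sum
  -- over `d` neighbours is rounded up once, not `d` times.
  few-∃ : ∀ {U D M w S d} .{{_ : NonZero D}} {A : Fin n → Pred (Subset n) 0ℓ} → ∣ S ∣ ≡ d →
          (∀ {u} → u ∈ S → Few U (A u) (D * d) M w) → Few U (λ F → ∃ λ u → u ∈ S × A u F) D M w
  few-∃ {d = zero} ∣S∣≡0 few = few-∅ λ _ (u , u∈S , _) → ∣p∣≡0⇒∉ ∣S∣≡0 u∈S
  few-∃ {D = D} {M} {w} {S} {d@(suc _)} {A} ∣S∣≡d few Q? h =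
    bound-cancel d (subst (λ k → Bound (D * d) M _ (k * w)) ∣S∣≡d (few-∃-sum S A few Q? h))

  few-restrict : ∀ {U D M w} (R I : Subset n) → (∀ {i w} → i ∈ I → w ∈ U → i ~ w → w ∈ R) →
                 Bound D M (φ (U ─ R)) w → Few U (Agrees R I) D M w
  few-restrict {U} R I closed b Q? h = bound-mono
    (count-restrict R I Q? (maxIn? (U ─ R)) (λ F q → proj₂ (h q))
      λ F q → MaxIn-─ closed (proj₂ (h q)) (proj₁ (h q))) ≤-refl b

  few-delete : ∀ {U D M w} v → Bound D M (φ (U - v)) w → Few U (v ∉_) D M w
  few-delete v b = few-mono
    (λ {F} _ v∉F x x∈ → mk⇔ (λ x∈F → contradiction (subst (_∈ F) (x∈⁅y⁆⇒x≡y v x∈) x∈F) v∉F) (⊥-elim ∘ ∉⊥))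
    ≤-refl (few-restrict ⁅ v ⁆ ⊥ (⊥-elim ∘ ∉⊥) b)

  -- `I` is a union of connected components of `G[F]`, not necessarily a single one, so such
  -- patterns can be concatenated.
  Component : List (Fin n) → Pred (Subset n) 0ℓ
  Component I F = All (_∈ F) I × (∀ {i w} → i ∈ₗ I → w ∈ F → i ~ w → w ∈ₗ I)

  closed-nbr? : (I : List (Fin n)) → Decidable (λ w → Any (λ i → w ≡ i ⊎ i ~ w) I)
  closed-nbr? I w = Any.any? (λ i → (w ≟ i) ⊎-dec (i ~? w)) I

  N[_] : List (Fin n) → Subset n
  N[ I ] = comprehend (closed-nbr? I)

  ∈N[]-self : ∀ {I i} → i ∈ₗ I → i ∈ N[ I ]
  ∈N[]-self {I} i∈I = ∈-comprehend⁺ (closed-nbr? I) (Any.map inj₁ i∈I)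

  ∈N[]-nbr : ∀ {I i w} → i ∈ₗ I → i ~ w → w ∈ N[ I ]
  ∈N[]-nbr {I} i∈I i~w = ∈-comprehend⁺ (closed-nbr? I) (Any.map (λ { refl → inj₂ i~w }) i∈I)

  -- The trace of `F` on the closed neighbourhood of `I` is forced to be `I`: a vertex of `F`
  -- adjacent to `I` belongs to `I` already.
  few-component-bound : ∀ {U D M w} I → Bound D M (φ (U ─ N[ I ])) w → Few U (Component I) D M w
  few-component-bound {U} I b = few-mono agrees ≤-refl
    (few-restrict N[ I ] (comprehend inI?) (λ i∈ w∈U i~w → ∈N[]-nbr (∈-comprehend⁻ inI? i∈) i~w) b)
    where
    inI? : Decidable (_∈ₗ I)
    inI? w = Any.any? (w ≟_) I
    split : ∀ {w J} → Any (λ i → w ≡ i ⊎ i ~ w) J → w ∈ₗ J ⊎ ∃ λ i → i ∈ₗ J × i ~ w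
    split (here (inj₁ eq)) = inj₁ (here eq)
    split (here (inj₂ i~w)) = inj₂ (_ , here refl , i~w)
    split (there a) = Sum.map there (λ (i , i∈ , i~w) → i , there i∈ , i~w) (split a)
    agrees : ∀ {F} → MaxIn U F → Component I F → Agrees N[ I ] (comprehend inI?) F
    agrees {F} _ (I⊆F , closed) w w∈ = mk⇔
      (λ w∈F → ∈-comprehend⁺ inI? ([ id , (λ (i , i∈ , i~w) → closed i∈ w∈F i~w) ]′
                 (split (∈-comprehend⁻ (closed-nbr? I) w∈))))
      (λ w∈I → All.lookup I⊆F (∈-comprehend⁻ inI? w∈I))

  Ratio : Subset n → (D c : ℕ) → Set
  Ratio U D c = Bound D (6 ^ ∣ U ∣) (φ U) c

  -- The induction hypothesis, in its weak form without strictness.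
  Small : Subset n → Set
  Small U = ∀ U′ → ∣ U′ ∣ < ∣ U ∣ → Ratio U′ 1 1

  small-⊆ : ∀ {U V} → V ⊆ U → Small U → Small V
  small-⊆ V⊆U s U′ lt = s U′ (≤-trans lt (p⊆q⇒∣p∣≤∣q∣ V⊆U))

  few-component : ∀ {U D w} → Small U → ∀ I k → 1 ≤ k → ∣ U ─ N[ I ] ∣ + k ≤ ∣ U ∣ →
                  Weight D 1 1 w k → Few U (Component I) D (6 ^ ∣ U ∣) w
  few-component {U} {D} {w} s I k 1≤k le q = few-component-bound I
    (bound-shift {D} {1} {w = w} k (s (U ─ N[ I ]) (≤-trans (≤-reflexive (+-comm 1 _)) (≤-trans (+-monoʳ-≤ _ 1≤k) le))) le q)

  component-isolated : ∀ {v F} → v ∈ F → (∀ {w} → w ∈ F → ¬ v ~ w) → Component (v ∷ []) F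
  component-isolated v∈F iso = v∈F ∷ [] , λ { (here refl) w∈F v~w → contradiction v~w (iso w∈F) }

  component-edge : ∀ {u v F} → Dis F → u ∈ F → v ∈ F → u ~ v → Component (u ∷ v ∷ []) F
  component-edge d u∈F v∈F u~v = u∈F ∷ v∈F ∷ [] , λ where
    (here refl) w∈F u~w → there (here (d u∈F w∈F v∈F u~w u~v))
    (there (here refl)) w∈F v~w → here (d v∈F w∈F u∈F v~w (~-sym u~v))

  matched? : ∀ v F → Dec (∃ λ u → u ∈ F × v ~ u)
  matched? v F = any? λ u → (u ∈? F) ×-dec (v ~? u)

-- Branching on a vertex


module Branching {n : ℕ} (G : Graph n) (tf : TriangleFree G) where
  open Dissociation G

  no-triangle : ∀ {u v w} → u ~ v → v ~ w → ¬ u ~ w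
  no-triangle {u} {v} {w} u~v v~w u~w = tf (u , v , w , u~v , v~w , u~w)

  N-sym : ∀ {U u v} → u ∈ U → v ∈ N U u → u ∈ N U v
  N-sym {U} u∈U v∈ = ∈N⁺ {U} (~-sym (∈N⇒~ U v∈)) u∈U

  N-delete⁺ : ∀ {U v x y} → y ∈ N U v → y ≢ x → y ∈ N (U - x) v
  N-delete⁺ {U} y∈ y≢x = ∈N⁺ (∈N⇒~ U y∈) (x∈p∧x≢y⇒x∈p-y (∈N⇒∈ U y∈) y≢x)

  N-delete⁻ : ∀ U {v} x {y} → y ∈ N (U - x) v → y ∈ N U v
  N-delete⁻ U x y∈ = ∈N⁺ (∈N⇒~ (U - x) y∈) (x∈p-y⇒x∈p U x (∈N⇒∈ (U - x) y∈))

  deg-delete-nbr : ∀ {U v x m} → v ~ x → x ∈ U → deg U v ≡ suc m → deg (U - x) v ≡ m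
  deg-delete-nbr {U} {v} {x} v~x x∈U eq = trans (≤-antisym
      (p⊆q⇒∣p∣≤∣q∣ {p = N (U - x) v} {q = N U v - x} λ y∈ →
        x∈p∧x≢y⇒x∈p-y (N-delete⁻ U x y∈) (x∈p-y⇒x≢y U x (∈N⇒∈ (U - x) y∈)))
      (p⊆q⇒∣p∣≤∣q∣ {p = N U v - x} {q = N (U - x) v} λ y∈ →
        N-delete⁺ {U} (x∈p-y⇒x∈p (N U v) x y∈) (x∈p-y⇒x≢y (N U v) x y∈)))
    (∣p-x∣≡ (∈N⁺ {U} v~x x∈U) eq)

  deg-delete-other : ∀ {U v x} → ¬ v ~ x → deg (U - x) v ≡ deg U v
  deg-delete-other {U} {v} {x} v≁x = ≤-antisym
    (p⊆q⇒∣p∣≤∣q∣ {p = N (U - x) v} {q = N U v} (N-delete⁻ U x))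
    (p⊆q⇒∣p∣≤∣q∣ {p = N U v} {q = N (U - x) v} λ y∈ → N-delete⁺ {U} y∈ λ { refl → v≁x (∈N⇒~ U y∈) })

  few-isolated : ∀ {U v D k w} → Small U → v ∈ U → suc (deg U v) ≡ k →
                 Weight D 1 1 w k → Few U (Component (v ∷ [])) D (6 ^ ∣ U ∣) w
  few-isolated {U} {v} {D} {k} {w} s v∈U refl = few-component {D = D} {w = w} s (v ∷ []) k (s≤s z≤n) (begin
      ∣ V ∣ + suc (deg U v)            ≡⟨ cong (λ z → ∣ V ∣ + (z + deg U v)) (∣⁅x⁆∣≡1 v) ⟨
      ∣ V ∣ + (∣ ⁅ v ⁆ ∣ + ∣ N U v ∣)  ≤⟨ ∣p∣+∣q∣+∣r∣≤ {p = V} {q = ⁅ v ⁆} {r = N U v} (p─q⊆p U N[ v ∷ [] ])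
           (λ x∈ → subst (_∈ U) (≡-sym (x∈⁅y⁆⇒x≡y v x∈)) v∈U) (∈N⇒∈ U)
           (λ x∈ x∈v → x∉p─q {p = U} x∈ (∈N[]-self {v ∷ []} (here (x∈⁅y⁆⇒x≡y v x∈v))))
           (λ x∈ x∈N → x∉p─q {p = U} x∈ (∈N[]-nbr {v ∷ []} (here refl) (∈N⇒~ U x∈N)))
           (λ x∈v x∈N → ~-irrefl (subst (v ~_) (x∈⁅y⁆⇒x≡y v x∈v) (∈N⇒~ U x∈N))) ⟩
      ∣ U ∣                            ∎)
    where
    open ≤-Reasoning
    V = U ─ N[ v ∷ [] ]

  -- The neighbourhoods of `u` and `v` are disjoint because there are no triangles, and both are
  -- removed, so at least `deg U u + deg U v` vertices disappear (`u` and `v` are counted as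
  -- neighbours of each other).
  few-matched : ∀ {U u v D k w} → Small U → u ∈ U → v ∈ N U u → k ≤ deg U u + deg U v → 1 ≤ k →
                Weight D 1 1 w k → Few U (Component (u ∷ v ∷ [])) D (6 ^ ∣ U ∣) w
  few-matched {U} {u} {v} {D} {k} {w} s u∈U v∈N k≤ 1≤k = few-component {D = D} {w = w} s I k 1≤k
    (≤-trans (+-monoʳ-≤ ∣ U ─ N[ I ] ∣ k≤) (∣p∣+∣q∣+∣r∣≤ {p = U ─ N[ I ]} {q = N U u} {r = N U v}
      (p─q⊆p U N[ I ]) (∈N⇒∈ U) (∈N⇒∈ U)
      (λ x∈ x∈N → x∉p─q {p = U} x∈ (∈N[]-nbr {I} (here refl) (∈N⇒~ U x∈N)))
      (λ x∈ x∈N → x∉p─q {p = U} x∈ (∈N[]-nbr {I} (there (here refl)) (∈N⇒~ U x∈N)))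
      (λ x∈u x∈v → no-triangle (∈N⇒~ U v∈N) (∈N⇒~ U x∈v) (∈N⇒~ U x∈u))))
    where
    I = u ∷ v ∷ []

  -- The three weights stand for `c·α⁻¹` (`v` deleted), `α^(-d-1)` (`v` isolated in `F`) and
  -- `d·α^(-d-e)` (`v` matched to one of its `d` neighbours, each of degree at least `e`). Any
  -- knowledge about `U - v` enters through `c`.
  vertex-bound : ∀ {U v D} d e {c w₁ w₂ w₃} .{{_ : NonZero D}} → Small U → v ∈ U → deg U v ≡ d →
                 (∀ {u} → u ∈ N U v → e ≤ deg U u) → Ratio (U - v) D c →
                 Weight D c D w₁ 1 →
                 Weight D 1 1 w₂ (suc d) →
                 Weight (D * d) 1 1 w₃ (d + e) → Ratio U D (w₁ + (w₂ + w₃))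
  vertex-bound {U} {v} {D} d e {c} {w₁} {w₂} {w₃} s v∈U refl e≤ r p₁ p₂ p₃ =
    few⇒bound split
      (few-⊎ {w = w₁} {v = w₂ + w₃} (λ _ → id) (few-delete v (bound-shift 1 r (≤-reflexive (∣p-x∣ v∈U)) p₁))
        (few-⊎ {w = w₂} {v = w₃} (λ _ → id) (few-isolated s v∈U refl p₂)
          (few-∃ {S = N U v} refl λ u∈N →
            few-matched s v∈U u∈N (+-monoʳ-≤ d (e≤ u∈N)) (≤-trans (x∈p⇒1≤∣p∣ u∈N) (m≤m+n d e)) p₃)))
    where
    split : ∀ {F} → MaxIn U F → v ∉ F ⊎ (Component (v ∷ []) F ⊎
            ∃ λ u → u ∈ N U v × Component (v ∷ u ∷ []) F)
    split {F} M with v ∈? F | matched? v F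
    ... | no v∉F | _ = inj₁ v∉F
    ... | yes v∈F | yes (u , u∈F , v~u) = inj₂ (inj₂ (u , ∈N⁺ v~u (sub M u∈F) , component-edge (dis M) v∈F u∈F v~u))
    ... | yes v∈F | no ¬m = inj₂ (inj₁ (component-isolated v∈F λ w∈F v~w → ¬m (_ , w∈F , v~w)))

  -- By maximality an isolated `v` lies in every maximum set, so it offers no choice. The gain of a
  -- factor `α` comes from the loss of a vertex.
  isolated-bound : ∀ {U v D M w} → v ∈ U → deg U v ≡ 0 → Bound D M (φ (U - v)) w → Bound D M (φ U) w
  isolated-bound {U} {v} v∈U d≡0 b = few⇒bound agrees (few-restrict ⁅ v ⁆ ⁅ v ⁆
      (λ {i} {w} i∈ w∈U i~w → contradiction (subst (_~ w) (x∈⁅y⁆⇒x≡y v i∈) i~w) (no-nbr w∈U)) b)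
    where
    no-nbr : ∀ {w} → w ∈ U → ¬ v ~ w
    no-nbr w∈U v~w = ∣p∣≡0⇒∉ d≡0 (∈N⁺ v~w w∈U)
    agrees : ∀ {F} → MaxIn U F → Agrees ⁅ v ⁆ ⁅ v ⁆ F
    agrees {F} M w w∈v with v ∈? F
    ... | yes v∈F = mk⇔ (λ _ → w∈v) (λ _ → subst (_∈ F) (≡-sym (x∈⁅y⁆⇒x≡y v w∈v)) v∈F)
    ... | no v∉F = ⊥-elim (unaddable M v∈U v∉F
      (λ x∈F _ v~x _ → contradiction v~x (no-nbr (sub M x∈F)))
      (λ x∈F _ v~x → contradiction v~x (no-nbr (sub M x∈F))))

  leaf-nbr : ∀ {U u v x} → u ∈ U → v ∈ N U u → deg U v ≡ 1 → x ∈ U → v ~ x → x ≡ u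
  leaf-nbr {U} {u} {v} u∈U v∈N d≡1 x∈U v~x =
    ∣p∣≤1⇒unique (≤-reflexive d≡1) (∈N⁺ v~x x∈U) (N-sym {U} u∈U v∈N)

  -- The branching is on the neighbour `u` of the leaf: it is absent, matched to `v`, or matched to
  -- one of its `k` other neighbours. It cannot be isolated in `F`, since `v` could then be added.
  -- The exponents are the degree sums: `(k + 1) + 1` for `v` and at least `(k + 1) + e` for another
  -- neighbour.
  leaf-bound : ∀ {U u v D} k e {c w₁ w₂ w₃} .{{_ : NonZero D}} → Small U → u ∈ U → v ∈ N U u → deg U v ≡ 1 → deg U u ≡ suc k →
               (∀ {w} → w ∈ N U u → w ≢ v → e ≤ deg U w) → Ratio (U - u) D c →
               Weight D c D w₁ 1 →
               Weight D 1 1 w₂ (suc (suc k)) →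
               Weight (D * k) 1 1 w₃ (k + suc e) → Ratio U D (w₁ + (w₂ + w₃))
  leaf-bound {U} {u} {v} {D} k e {c} {w₁} {w₂} {w₃} s u∈U v∈N dv≡1 du≡ e≤ r p₁ p₂ p₃ =
    few⇒bound split
      (few-⊎ {w = w₁} {v = w₂ + w₃} (λ _ → id) (few-delete u (bound-shift 1 r (≤-reflexive (∣p-x∣ u∈U)) p₁))
        (few-⊎ {w = w₂} {v = w₃} (λ _ → id)
          (few-matched s u∈U v∈N (≤-reflexive (trans (+-comm 1 (suc k)) (≡-sym (cong₂ _+_ du≡ dv≡1)))) (s≤s z≤n) p₂)
          (few-∃ {S = N U u - v} (∣p-x∣≡ v∈N du≡) λ w∈ →
            few-matched s u∈U (x∈p-y⇒x∈p (N U u) v w∈)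
              (≤-trans (≤-reflexive (+-suc k e)) (+-mono-≤ (≤-reflexive (≡-sym du≡))
                (e≤ (x∈p-y⇒x∈p (N U u) v w∈) (x∈p-y⇒x≢y (N U u) v w∈)))) (≤-trans (s≤s z≤n) (m≤n+m (suc e) k)) p₃)))
    where
    split : ∀ {F} → MaxIn U F → u ∉ F ⊎ (Component (u ∷ v ∷ []) F ⊎
            ∃ λ w → w ∈ N U u - v × Component (u ∷ w ∷ []) F)
    split {F} M with u ∈? F | v ∈? F | matched? u F
    ... | no u∉F | _ | _ = inj₁ u∉F
    ... | yes u∈F | yes v∈F | _ = inj₂ (inj₁ (component-edge (dis M) u∈F v∈F (∈N⇒~ U v∈N)))
    ... | yes u∈F | no v∉F | yes (w , w∈F , u~w) = inj₂ (inj₂ (w ,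
      x∈p∧x≢y⇒x∈p-y (∈N⁺ u~w (sub M w∈F)) (λ { refl → v∉F w∈F }) , component-edge (dis M) u∈F w∈F u~w))
    ... | yes u∈F | no v∉F | no ¬m = ⊥-elim (unaddable M (∈N⇒∈ U v∈N) v∉F
      (λ x∈F y∈F v~x v~y → trans (only-u (sub M x∈F) v~x) (≡-sym (only-u (sub M y∈F) v~y)))
      (λ x∈F y∈F v~x x~y → ¬m (_ , y∈F , subst (_~ _) (only-u (sub M x∈F) v~x) x~y)))
      where
      only-u : ∀ {x} → x ∈ U → v ~ x → x ≡ u
      only-u = leaf-nbr u∈U v∈N dv≡1

-- Graphs with a leaf


weight-mono : ∀ {D c E w j k} → Weight D c E w j → j ≤ k → Weight D c E w k
weight-mono {E = E} {w} (weight p) j≤k = weight (≤-trans p (*-monoʳ-≤ ((E * w) ^ 4) (^-monoʳ-≤ 6 j≤k)))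

-- From `k = 2` on, `k·α^(-k)` decreases, so a weight computed at the smallest degree serves for all
-- larger degrees.
weight-growth : ∀ {D w} j k e → 2 ≤ j → j ≤ k → Weight (D * j) 1 1 w (j + e) → Weight (D * k) 1 1 w (k + e)
weight-growth {D} {w} j k e 2≤j j≤k (weight p) = weight (begin
    (D * k * 1) ^ 4                          ≡⟨ expand k ⟩
    D ^ 4 * k ^ 4                            ≡⟨ cong (λ z → D ^ 4 * z ^ 4) (m∸n+n≡m j≤k) ⟨
    D ^ 4 * (k ∸ j + j) ^ 4                  ≤⟨ ^4-growth (D ^ 4) ((1 * w) ^ 4) (j + e) (k ∸ j) 2≤j
                                                  (subst (_≤ (1 * w) ^ 4 * 6 ^ (j + e)) (expand j) p) ⟩
    (1 * w) ^ 4 * 6 ^ (k ∸ j + (j + e))      ≡⟨ cong (λ z → (1 * w) ^ 4 * 6 ^ z)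
                                                  (trans (≡-sym (+-assoc (k ∸ j) j e)) (cong (_+ e) (m∸n+n≡m j≤k))) ⟩
    (1 * w) ^ 4 * 6 ^ (k + e)                ∎)
  where
  open ≤-Reasoning
  expand : ∀ i → (D * i * 1) ^ 4 ≡ D ^ 4 * i ^ 4
  expand i = trans (cong (_^ 4) (*-identityʳ (D * i))) (^4-distrib-* D i)

-- Ratios φ U / α^|U| are given in units of 10⁻⁴, rounded up: for instance 6390 stands for α⁻¹ = 0.63894….
module Leaves {n : ℕ} (G : Graph n) (tf : TriangleFree G) where
  open Dissociation G
  open Branching G tf

  ratio-mono : ∀ {U D c} c′ → c ≤ c′ → Ratio U D c → Ratio U D c′
  ratio-mono c′ le = bound-mono ≤-refl le

  isolated-ratio : ∀ {U v D E c w} .{{_ : NonZero E}} → v ∈ U → deg U v ≡ 0 → Ratio (U - v) E c →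
                   Weight D c E w 1 → Ratio U D w
  isolated-ratio v∈U d≡0 r p = isolated-bound v∈U d≡0 (bound-shift 1 r (≤-reflexive (∣p-x∣ v∈U)) p)

  ∣U-v∣<∣U∣ : ∀ {U : Subset n} {v} → v ∈ U → ∣ U - v ∣ < ∣ U ∣
  ∣U-v∣<∣U∣ v∈U = ≤-reflexive (trans (+-comm 1 _) (∣p-x∣ v∈U))

  small-delete : ∀ U v → Small U → Small (U - v)
  small-delete U v = small-⊆ (x∈p-y⇒x∈p U v)

  OtherLeaf : Subset n → Fin n → Fin n → Set
  OtherLeaf U u v = ∃ λ w → w ∈ N U u × w ≢ v × deg U w ≡ 1

  otherLeaf? : ∀ U u v → Dec (OtherLeaf U u v)
  otherLeaf? U u v = any? λ w → (w ∈? N U u) ×-dec ¬? (w ≟ v) ×-dec (deg U w ℕ.≟ 1)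

  1≤deg : ∀ {U u w} → u ∈ U → w ∈ N U u → 1 ≤ deg U w
  1≤deg u∈U w∈N = x∈p⇒1≤∣p∣ (N-sym u∈U w∈N)

  no-other-leaf⇒2≤deg : ∀ {U u v w} → u ∈ U → ¬ OtherLeaf U u v → w ∈ N U u → w ≢ v → 2 ≤ deg U w
  no-other-leaf⇒2≤deg u∈U ¬o w∈N w≢v = ≤∧≢⇒< (1≤deg u∈U w∈N) λ eq → ¬o (_ , w∈N , w≢v , ≡-sym eq)

  module _ {U u v} (small : Small U) (u∈U : u ∈ U) (v∈N : v ∈ N U u) (leaf : deg U v ≡ 1) where

    v∈U-u : v ∈ U - u
    v∈U-u = x∈p∧x≢y⇒x∈p-y (∈N⇒∈ U v∈N) λ { refl → ~-irrefl (∈N⇒~ U v∈N) }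

    isolated : deg (U - u) v ≡ 0
    isolated = deg-delete-nbr (~-sym (∈N⇒~ U v∈N)) u∈U leaf

    -- Deleting `u` isolates `v`, which then contributes no choice but still counts as a vertex;
    -- hence the ratio `α⁻¹`. A second leaf at `u` gives `α⁻² < 0.4083` in the same way.
    ratio-delete : Ratio (U - u) 10000 6390
    ratio-delete = isolated-ratio {D = 10000} {E = 1} {c = 1} {w = 6390} v∈U-u isolated
      (small (U - u - v) (<-trans (∣U-v∣<∣U∣ v∈U-u) (∣U-v∣<∣U∣ u∈U))) computed

    module _ {w} (w∈N : w ∈ N U u) (w≢v : w ≢ v) where

      w∈U-u-v : w ∈ U - u - v
      w∈U-u-v = x∈p∧x≢y⇒x∈p-y (x∈p∧x≢y⇒x∈p-y (∈N⇒∈ U w∈N) (λ { refl → ~-irrefl (∈N⇒~ U w∈N) })) w≢v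

      deg-U-u-v : ∀ {m} → deg U w ≡ suc m → deg (U - u - v) w ≡ m
      deg-U-u-v eq = trans (deg-delete-other λ w~v → no-triangle (∈N⇒~ U w∈N) w~v (∈N⇒~ U v∈N))
        (deg-delete-nbr (~-sym (∈N⇒~ U w∈N)) u∈U eq)

      ratio-delete₂ : deg U w ≡ 1 → Ratio (U - u) 10000 4083
      ratio-delete₂ leaf′ = isolated-ratio {D = 10000} {E = 10000} {c = 6390} {w = 4083} v∈U-u isolated
        (isolated-ratio {D = 10000} {E = 1} {c = 1} {w = 6390} w∈U-u-v (deg-U-u-v leaf′)
          (small (U - u - v - w) (<-trans (∣U-v∣<∣U∣ w∈U-u-v) (<-trans (∣U-v∣<∣U∣ v∈U-u) (∣U-v∣<∣U∣ u∈U))))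
          computed) computed

    -- The largest of the totals is 9084, for `deg U u` at least 3. When `u` has degree 2, using
    -- only that its other neighbour has degree at least 1 would give 9301; hence the distinction
    -- whether that neighbour is a leaf.
    leaf-ratio : Ratio U 10000 9100
    leaf-ratio with deg U u in du
    ... | zero = contradiction v∈N (∣p∣≡0⇒∉ du)
    ... | suc zero = ratio-mono 9100 (≤ᵇ⇒≤ _ 9100 tt)
      (leaf-bound 0 1 {w₁ = 4083} {w₂ = 4083} {w₃ = 0} small u∈U v∈N leaf du (λ w∈N _ → 1≤deg u∈U w∈N) ratio-delete
        computed computed computed)
    ... | suc k@(suc (suc _)) = ratio-mono 9100 (≤ᵇ⇒≤ _ 9100 tt)
      (leaf-bound k 1 {w₁ = 4083} {w₂ = 1667} {w₃ = 3334} small u∈U v∈N leaf du (λ w∈N _ → 1≤deg u∈U w∈N) ratio-delete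
        computed (weight-mono {10000} {1} {1} {1667} {4} computed (s≤s (s≤s (s≤s (s≤s z≤n)))))
        (weight-growth {10000} {3334} 2 k 2 ≤-refl (s≤s (s≤s z≤n)) computed))
    ... | suc (suc zero) with otherLeaf? U u v
    ...   | yes (w , w∈N , w≢v , leaf′) = ratio-mono 9100 (≤ᵇ⇒≤ _ 9100 tt)
      (leaf-bound 1 1 {w₁ = 2609} {w₂ = 2609} {w₃ = 2609} small u∈U v∈N leaf du (λ w∈N _ → 1≤deg u∈U w∈N)
        (ratio-delete₂ w∈N w≢v leaf′) computed computed computed)
    ...   | no ¬o = ratio-mono 9100 (≤ᵇ⇒≤ _ 9100 tt)
      (leaf-bound 1 2 {w₁ = 4083} {w₂ = 2609} {w₃ = 1667} small u∈U v∈N leaf du (no-other-leaf⇒2≤deg u∈U ¬o)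
        ratio-delete computed computed computed)

  leaf-ratio′ : ∀ {U v} → Small U → v ∈ U → deg U v ≡ 1 → Ratio U 10000 9100
  leaf-ratio′ {U} {v} s v∈U leaf with ∣p∣≡suc⇒pick {p = N U v} leaf
  ... | u , u∈N , _ = leaf-ratio s (∈N⇒∈ U u∈N) (N-sym {U} v∈U u∈N) leaf

  module _ {U u v} (small : Small U) (u∈U : u ∈ U) (v∈N : v ∈ N U u) (leaf : deg U v ≡ 1) where

    -- Either deleting `u` improves the first branch, or the branches matching `u` remove more
    -- vertices. Another leaf at `u` becomes isolated as well; a neighbour of degree 2 becomes a
    -- leaf, giving 0.91 times the `α⁻¹` of the isolated `v`, below 0.5815; otherwise all other
    -- neighbours have degree at least 3.
    leaf-cases : Ratio (U - u) 10000 4083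
               ⊎ (Ratio (U - u) 10000 5815 × (∀ {w} → w ∈ N U u → w ≢ v → 2 ≤ deg U w))
               ⊎ (∀ {w} → w ∈ N U u → w ≢ v → 3 ≤ deg U w)
    leaf-cases with otherLeaf? U u v
    ... | yes (w , w∈N , w≢v , leaf′) = inj₁ (ratio-delete₂ small u∈U v∈N leaf w∈N w≢v leaf′)
    ... | no ¬o with any? (λ w → (w ∈? N U u) ×-dec ¬? (w ≟ v) ×-dec (deg U w ℕ.≟ 2))
    ...   | yes (w , w∈N , w≢v , d≡2) = inj₂ (inj₁ (ratio , no-other-leaf⇒2≤deg u∈U ¬o))
      where
      ratio : Ratio (U - u) 10000 5815
      ratio = isolated-ratio {c = 9100} (v∈U-u small u∈U v∈N leaf) (isolated small u∈U v∈N leaf)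
        (leaf-ratio′ (small-delete (U - u) v (small-delete U u small)) (w∈U-u-v small u∈U v∈N leaf w∈N w≢v)
          (deg-U-u-v small u∈U v∈N leaf w∈N w≢v d≡2)) computed
    ...   | no ¬2 = inj₂ (inj₂ λ w∈N w≢v →
      ≤∧≢⇒< (no-other-leaf⇒2≤deg u∈U ¬o w∈N w≢v) λ eq → ¬2 (_ , w∈N , w≢v , ≡-sym eq))

    -- The totals are at most 7992. The general leaf ratio 9100 would be too weak for
    -- `deg3-deg2-strict`, whose total would become 5815 + 1667 + 3195.
    leaf-ratio-deg2 : deg U u ≡ 2 → Ratio U 10000 8000
    leaf-ratio-deg2 du with leaf-cases
    ... | inj₁ r = ratio-mono 8000 (≤ᵇ⇒≤ _ 8000 tt)
      (leaf-bound 1 1 {w₁ = 2609} {w₂ = 2609} {w₃ = 2609} small u∈U v∈N leaf du (λ w∈N _ → 1≤deg u∈U w∈N) r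
        computed computed computed)
    ... | inj₂ (inj₁ (r , 2≤)) = ratio-mono 8000 (≤ᵇ⇒≤ _ 8000 tt)
      (leaf-bound 1 2 {w₁ = 3716} {w₂ = 2609} {w₃ = 1667} small u∈U v∈N leaf du 2≤ r computed computed computed)
    ... | inj₂ (inj₂ 3≤) = ratio-mono 8000 (≤ᵇ⇒≤ _ 8000 tt)
      (leaf-bound 1 3 {w₁ = 4083} {w₂ = 2609} {w₃ = 1065} small u∈U v∈N leaf du 3≤
        (ratio-delete small u∈U v∈N leaf) computed computed computed)

    -- The totals are at most 7610. The sharper 7700 is needed in `cubic-strict`: with 8000 its
    -- total would be 10082.
    leaf-ratio-deg3 : deg U u ≡ 3 → Ratio U 10000 7700
    leaf-ratio-deg3 du with leaf-cases
    ... | inj₁ r = ratio-mono 7700 (≤ᵇ⇒≤ _ 7700 tt)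
      (leaf-bound 2 1 {w₁ = 2609} {w₂ = 1667} {w₃ = 3334} small u∈U v∈N leaf du (λ w∈N _ → 1≤deg u∈U w∈N) r
        computed computed computed)
    ... | inj₂ (inj₁ (r , 2≤)) = ratio-mono 7700 (≤ᵇ⇒≤ _ 7700 tt)
      (leaf-bound 2 2 {w₁ = 3716} {w₂ = 1667} {w₃ = 2130} small u∈U v∈N leaf du 2≤ r computed computed computed)
    ... | inj₂ (inj₂ 3≤) = ratio-mono 7700 (≤ᵇ⇒≤ _ 7700 tt)
      (leaf-bound 2 3 {w₁ = 4083} {w₂ = 1667} {w₃ = 1361} small u∈U v∈N leaf du 3≤
        (ratio-delete small u∈U v∈N leaf) computed computed computed)

-- Vertices of degree other than 2

module DegreeCases {n : ℕ} (G : Graph n) (tf : TriangleFree G) where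
  open Dissociation G
  open Branching G tf
  open Leaves G tf

  Strict : Subset n → Set
  Strict U = φ U ^ 4 < 6 ^ ∣ U ∣

  strict : ∀ {U c} → c < 10000 → Ratio U 10000 c → Strict U
  strict {U} = bound-strict {{m^n≢0 6 ∣ U ∣}}

  ratio-trivial : ∀ {U v} → Small U → v ∈ U → Ratio (U - v) 10000 10000
  ratio-trivial {U} {v} small v∈U = bound-shift {E = 1} {m = ∣ U - v ∣} {m′ = ∣ U - v ∣} {c = 1} 0 (small (U - v) (∣U-v∣<∣U∣ v∈U))
    (≤-reflexive (+-identityʳ (∣ U - v ∣))) computed

  module _ {U v} (small : Small U) (v∈U : v ∈ U) where

    isolated-strict : deg U v ≡ 0 → Strict U
    isolated-strict d = strict (≤ᵇ⇒≤ _ 10000 tt)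
      (isolated-ratio {c = 10000} {w = 6390} v∈U d (ratio-trivial small v∈U) computed)

    leaf-strict : deg U v ≡ 1 → Strict U
    leaf-strict d = strict (≤ᵇ⇒≤ _ 10000 tt) (leaf-ratio′ small v∈U d)

    -- The induction hypothesis for `U - v` suffices: the total is 9245 at degree 5, and the second
    -- and third terms decrease with `d`.
    deg≥5-strict : ∀ d → deg U v ≡ d → 5 ≤ d → (∀ {u} → u ∈ N U v → 2 ≤ deg U u) → Strict U
    deg≥5-strict d eq 5≤d 2≤ = strict (≤ᵇ⇒≤ _ 10000 tt)
      (vertex-bound d 2 {c = 10000} {w₁ = 6390} {w₂ = 681} {w₃ = 2174} small v∈U eq 2≤ (ratio-trivial small v∈U)
        computed (weight-mono {10000} {1} {1} {681} {6} {suc d} computed (s≤s 5≤d))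
        (weight-growth {10000} {2174} 5 d 2 (s≤s (s≤s z≤n)) 5≤d computed))

    -- With neighbours of degree at least 2 and nothing known about `U - v` the total would be
    -- 10177. A neighbour of degree 2 becomes a leaf of `U - v` and improves the first term; without
    -- one, the matched branches remove seven vertices each.
    deg4-strict : deg U v ≡ 4 → (∀ {u} → u ∈ N U v → 2 ≤ deg U u) → Strict U
    deg4-strict eq 2≤ with any? (λ a → (a ∈? N U v) ×-dec (deg U a ℕ.≟ 2))
    ... | yes (a , a∈N , d≡2) = strict (≤ᵇ⇒≤ _ 10000 tt)
      (vertex-bound 4 2 {c = 9100} {w₁ = 5815} {w₂ = 1065} {w₃ = 2722} small v∈U eq 2≤
        (leaf-ratio′ (small-delete U v small)
          (x∈p∧x≢y⇒x∈p-y (∈N⇒∈ U a∈N) λ { refl → ~-irrefl (∈N⇒~ U a∈N) })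
          (deg-delete-nbr (~-sym (∈N⇒~ U a∈N)) v∈U d≡2))
        computed computed computed)
    ... | no ¬2 = strict (≤ᵇ⇒≤ _ 10000 tt)
      (vertex-bound 4 3 {c = 10000} {w₁ = 6390} {w₂ = 1065} {w₃ = 1739} small v∈U eq
        (λ u∈N → ≤∧≢⇒< (2≤ u∈N) λ eq′ → ¬2 (_ , u∈N , ≡-sym eq′)) (ratio-trivial small v∈U)
        computed computed computed)

  module _ {U v a} (small : Small U) (v∈U : v ∈ U) (a∈N : a ∈ N U v) where

    private
      v~a : v ~ a
      v~a = ∈N⇒~ U a∈N

    -- Deleting `v` turns `a` into a leaf. Its remaining neighbour `x` is not adjacent to `v`, as
    -- there are no triangles, so it keeps its degree 2 or 3 and one of the refined leaf ratios
    -- applies. The total is 9974.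
    deg3-deg2-strict : deg U v ≡ 3 → deg U a ≡ 2 → (∀ {u} → u ∈ U → deg U u ≡ 2 ⊎ deg U u ≡ 3) → Strict U
    deg3-deg2-strict dv da 2or3 with ∣p∣≡suc⇒pick {p = N (U - v) a} (deg-delete-nbr (~-sym v~a) v∈U da)
    ... | x , x∈N , _ = strict (≤ᵇ⇒≤ _ 10000 tt)
      (vertex-bound 3 2 {c = 8000} {w₁ = 5112} {w₂ = 1667} {w₃ = 3195} small v∈U dv
        (λ u∈N → [ ≤-reflexive ∘ ≡-sym , (λ eq → ≤-trans (s≤s (s≤s z≤n)) (≤-reflexive (≡-sym eq))) ]′ (2or3 (∈N⇒∈ U u∈N)))
        ratio computed computed computed)
      where
      a∈U-v : a ∈ U - v
      a∈U-v = x∈p∧x≢y⇒x∈p-y (∈N⇒∈ U a∈N) λ { refl → ~-irrefl v~a }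
      a-leaf : deg (U - v) a ≡ 1
      a-leaf = deg-delete-nbr (~-sym v~a) v∈U da
      x∈U-v : x ∈ U - v
      x∈U-v = ∈N⇒∈ (U - v) x∈N
      deg-x : deg (U - v) x ≡ deg U x
      deg-x = deg-delete-other λ x~v → no-triangle v~a (∈N⇒~ (U - v) x∈N) (~-sym x~v)
      ratio : Ratio (U - v) 10000 8000
      ratio with 2or3 (x∈p-y⇒x∈p U v x∈U-v)
      ... | inj₁ d≡2 = leaf-ratio-deg2 (small-delete U v small) x∈U-v (N-sym {U - v} a∈U-v x∈N) a-leaf (trans deg-x d≡2)
      ... | inj₂ d≡3 = ratio-mono 8000 (≤ᵇ⇒≤ _ 8000 tt)
        (leaf-ratio-deg3 (small-delete U v small) x∈U-v (N-sym {U - v} a∈U-v x∈N) a-leaf (trans deg-x d≡3))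

    -- Branching at `v` alone totals 10099. A second branching inside `U - v`, at another neighbour
    -- `x` of `a`, brings the ratio of `U - v` down to 4920 + 1667 + 3195 = 9782: once `v` and `x`
    -- are gone, `a` is a leaf at `y`, which still has degree 3. The final total is 9960.
    cubic-strict : deg U v ≡ 3 → (∀ {u w} → u ∈ U → w ∈ N U u → deg U u ≡ 3 → deg U w ≡ 3) → Strict U
    cubic-strict dv cubic with ∣p∣≡suc⇒pick {p = N (U - v) a} (deg-delete-nbr (~-sym v~a) v∈U (cubic v∈U a∈N dv))
    ... | x , x∈N , _
      with ∣p∣≡suc⇒pick {p = N (U - v - x) a} (deg-delete-nbr (∈N⇒~ (U - v) x∈N) (∈N⇒∈ (U - v) x∈N)
             (deg-delete-nbr (~-sym v~a) v∈U (cubic v∈U a∈N dv)))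
    ...   | y , y∈N , _ = strict (≤ᵇ⇒≤ _ 10000 tt)
      (vertex-bound 3 3 {c = 9782} {w₁ = 6251} {w₂ = 1667} {w₃ = 2042} small v∈U dv
        (λ u∈N → ≤-reflexive (≡-sym (cubic v∈U u∈N dv)))
        (vertex-bound 3 2 {c = 7700} {w₁ = 4920} {w₂ = 1667} {w₃ = 3195} (small-delete U v small) x∈U-v
          (trans (deg-delete-other x≁v) deg-x) nbr-x
          (leaf-ratio-deg3 (small-delete (U - v) x (small-delete U v small)) y∈V (N-sym {U - v - x} a∈V y∈N) a-leaf deg-y)
          computed computed computed)
        computed computed computed)
      where
      V = U - v - x
      a∈U : a ∈ U
      a∈U = ∈N⇒∈ U a∈N
      da : deg U a ≡ 3
      da = cubic v∈U a∈N dv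
      a~x : a ~ x
      a~x = ∈N⇒~ (U - v) x∈N
      a~y : a ~ y
      a~y = ∈N⇒~ V y∈N
      x∈U-v : x ∈ U - v
      x∈U-v = ∈N⇒∈ (U - v) x∈N
      x∈U : x ∈ U
      x∈U = x∈p-y⇒x∈p U v x∈U-v
      y∈V : y ∈ V
      y∈V = ∈N⇒∈ V y∈N
      y∈U : y ∈ U
      y∈U = x∈p-y⇒x∈p U v (x∈p-y⇒x∈p (U - v) x y∈V)
      a∈V : a ∈ V
      a∈V = x∈p∧x≢y⇒x∈p-y (x∈p∧x≢y⇒x∈p-y a∈U λ { refl → ~-irrefl v~a }) λ { refl → ~-irrefl a~x }
      x≁v : ¬ x ~ v
      x≁v x~v = no-triangle v~a a~x (~-sym x~v)
      y≁v : ¬ y ~ v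
      y≁v y~v = no-triangle v~a a~y (~-sym y~v)
      y≁x : ¬ y ~ x
      y≁x y~x = no-triangle a~y y~x a~x
      deg-x : deg U x ≡ 3
      deg-x = cubic a∈U (∈N⁺ a~x x∈U) da
      deg-y : deg V y ≡ 3
      deg-y = trans (deg-delete-other y≁x) (trans (deg-delete-other y≁v) (cubic a∈U (∈N⁺ a~y y∈U) da))
      a-leaf : deg V a ≡ 1
      a-leaf = deg-delete-nbr a~x x∈U-v (deg-delete-nbr (~-sym v~a) v∈U da)
      nbr-x : ∀ {w} → w ∈ N (U - v) x → 2 ≤ deg (U - v) w
      nbr-x {w} w∈ with w ~? v
      ... | yes w~v = ≤-reflexive (≡-sym (deg-delete-nbr w~v v∈U (cubic x∈U (N-delete⁻ U v w∈) deg-x)))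
      ... | no w≁v = ≤-trans (s≤s (s≤s z≤n)) 
        (≤-reflexive (≡-sym (trans (deg-delete-other w≁v) (cubic x∈U (N-delete⁻ U v w∈) deg-x))))

-- Cycles of length at least 5

module TwoRegular {n : ℕ} (G : Graph n) (tf : TriangleFree G) where
  open Dissociation G
  open Branching G tf
  open Leaves G tf
  open DegreeCases G tf

  -- Degree 2 with named and ordered neighbours, so that a cycle can be walked: the first neighbour
  -- is where the walk comes from, and `second-nbr` finds where it goes on.
  record TwoNbrs (U : Subset n) (v a b : Fin n) : Set where
    field
      v∈U : v ∈ U
      a∈U : a ∈ U
      b∈U : b ∈ U
      v~a : v ~ a
      v~b : v ~ b
      a≢b : a ≢ b
      only : ∀ {x} → x ∈ U → v ~ x → x ≡ a ⊎ x ≡ b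

  second-nbr : ∀ {U v a} → v ∈ U → deg U v ≡ 2 → a ∈ U → v ~ a → ∃ λ b → TwoNbrs U v a b
  second-nbr {U} {v} {a} v∈U d≡2 a∈U v~a with ∣p∣≡suc⇒pick {p = N U v - a} (∣p-x∣≡ (∈N⁺ v~a a∈U) d≡2)
  ... | b , b∈ , rest≡0 = b , record
    { v∈U = v∈U ; a∈U = a∈U ; b∈U = ∈N⇒∈ U b∈N ; v~a = v~a ; v~b = ∈N⇒~ U b∈N
    ; a≢b = λ a≡b → x∈p-y⇒x≢y (N U v) a b∈ (≡-sym a≡b) ; only = only }
    where
    b∈N : b ∈ N U v
    b∈N = x∈p-y⇒x∈p (N U v) a b∈
    only : ∀ {x} → x ∈ U → v ~ x → x ≡ a ⊎ x ≡ b
    only {x} x∈U v~x with x ≟ a | x ≟ b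
    ... | yes x≡a | _ = inj₁ x≡a
    ... | no _ | yes x≡b = inj₂ x≡b
    ... | no x≢a | no x≢b = contradiction
      (x∈p∧x≢y⇒x∈p-y (x∈p∧x≢y⇒x∈p-y (∈N⁺ v~x x∈U) x≢a) x≢b) (∣p∣≡0⇒∉ rest≡0)

  twoNbrs-swap : ∀ {U v a b} → TwoNbrs U v a b → TwoNbrs U v b a
  twoNbrs-swap t = record
    { v∈U = v∈U ; a∈U = b∈U ; b∈U = a∈U ; v~a = v~b ; v~b = v~a ; a≢b = a≢b ∘ ≡-sym
    ; only = λ x∈U v~x → Sum.swap (only x∈U v~x) }
    where open TwoNbrs t

  component-++ : ∀ {I J F} → Component I F → Component J F → Component (I ++ J) F
  component-++ {I} {J} (I⊆F , closedI) (J⊆F , closedJ) = All.++⁺ I⊆F J⊆F , λ i∈ w∈F i~w →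
    [ (λ i∈I → Any.++⁺ˡ (closedI i∈I w∈F i~w)) , (λ i∈J → Any.++⁺ʳ I (closedJ i∈J w∈F i~w)) ]′ (Any.++⁻ I i∈)

  few-component-list : ∀ {U D w} → Small U → ∀ I xs → 1 ≤ length xs → Unique xs → All (_∈ U) xs → All (_∈ N[ I ]) xs →
                       Weight D 1 1 w (length xs) → Few U (Component I) D (6 ^ ∣ U ∣) w
  few-component-list {U} s I xs 1≤ u xs⊆U xs⊆N q = few-component s I (length xs) 1≤
    (∣p∣+length≤ {p = U ─ N[ I ]} xs u xs⊆U (All.map (λ x∈N x∈ → x∉p─q {p = U} x∈ x∈N) xs⊆N) (p─q⊆p U N[ I ])) q

  -- A path x – a – v – b – y whose vertices have degree 2, with x ≢ y.
  module Path {U v a b x y x′ y′} (small : Small U)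
    (at-v : TwoNbrs U v a b) (at-a : TwoNbrs U a v x) (at-b : TwoNbrs U b v y)
    (at-x : TwoNbrs U x a x′) (at-y : TwoNbrs U y b y′) (x≢y : x ≢ y) where

    private
      module V = TwoNbrs at-v
      module A = TwoNbrs at-a
      module B = TwoNbrs at-b
      module X = TwoNbrs at-x
      module Y = TwoNbrs at-y

      a≢y : a ≢ y
      a≢y refl = no-triangle V.v~b B.v~b V.v~a
      b≢x : b ≢ x
      b≢x refl = no-triangle V.v~a A.v~b V.v~b

      deg-≥2 : ∀ {c d e} → TwoNbrs U c d e → 2 ≤ deg U c
      deg-≥2 {c} {d} {e} t = subst (λ z → z + 2 ≤ deg U c) (∣⊥∣≡0 n)
        (∣p∣+length≤ {p = ⊥} (d ∷ e ∷ []) ((T.a≢b ∷ []) ∷ [] ∷ [])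
          (∈N⁺ T.v~a T.a∈U ∷ ∈N⁺ T.v~b T.b∈U ∷ []) (∉⊥ ∷ ∉⊥ ∷ []) (⊥-elim ∘ ∉⊥))
        where module T = TwoNbrs t

      edge : ∀ {c d e f g} → TwoNbrs U c d e → TwoNbrs U d f g → Few U (Component (c ∷ d ∷ [])) 10000 (6 ^ ∣ U ∣) 1667
      edge t t′ = few-matched {k = 4} small T.v∈U (∈N⁺ T.v~a T.a∈U) (+-mono-≤ (deg-≥2 t) (deg-≥2 t′)) (s≤s z≤n) computed
        where module T = TwoNbrs t

      -- The pattern in which `b` is matched to `y` and `x` to `x′`, leaving out `v` and `a`. It is
      -- kept as bare membership because `x′` coincides with `y` in a pentagon and with `y′` in a
      -- hexagon, and then no dissociation set contains it.
      Far : Pred (Subset n) 0ℓ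
      Far F = b ∈ F × y ∈ F × x ∈ F × x′ ∈ F

    -- If `v ∉ F`, maximality forbids adding `v`, so `a` or `b` lies in `F`, and if only one of them
    -- does, it must be matched away from `v`. If `a ∉ F` as well, adding `a` must also fail: this
    -- forces `x ∈ F`, and `x` must be matched to `x′`.
    split : ∀ {F} → MaxIn U F → Component (v ∷ []) F ⊎ Component (v ∷ a ∷ []) F ⊎ Component (v ∷ b ∷ []) F
            ⊎ Component (a ∷ x ∷ []) F ⊎ Component (a ∷ b ∷ y ∷ []) F ⊎ Component (a ∷ b ∷ []) F ⊎ Far F
    split {F} M with v ∈? F | a ∈? F | b ∈? F
    ... | yes v∈F | yes a∈F | _ = inj₂ (inj₁ (component-edge (dis M) v∈F a∈F V.v~a))
    ... | yes v∈F | no _ | yes b∈F = inj₂ (inj₂ (inj₁ (component-edge (dis M) v∈F b∈F V.v~b)))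
    ... | yes v∈F | no a∉F | no b∉F = inj₁ (component-isolated v∈F λ w∈F v~w →
      [ (λ { refl → a∉F w∈F }) , (λ { refl → b∉F w∈F }) ]′ (V.only (sub M w∈F) v~w))
    ... | no v∉F | yes a∈F | b? with x ∈? F
    ...   | yes x∈F = inj₂ (inj₂ (inj₂ (inj₁ (component-edge (dis M) a∈F x∈F A.v~b))))
    ...   | no x∉F = a-isolated b?
      where
      no-nbr : ∀ {w} → w ∈ F → ¬ a ~ w
      no-nbr w∈F a~w = [ (λ { refl → v∉F w∈F }) , (λ { refl → x∉F w∈F }) ]′ (A.only (sub M w∈F) a~w)
      a-isolated : Dec (b ∈ F) → _
      a-isolated (no b∉F) = ⊥-elim (unaddable M V.v∈U v∉F
        (λ p∈F q∈F v~p v~q → trans (only-a p∈F v~p) (≡-sym (only-a q∈F v~q)))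
        (λ p∈F q∈F v~p p~q → no-nbr q∈F (subst (_~ _) (only-a p∈F v~p) p~q)))
        where
        only-a : ∀ {p} → p ∈ F → v ~ p → p ≡ a
        only-a p∈F v~p = [ id , (λ { refl → contradiction p∈F b∉F }) ]′ (V.only (sub M p∈F) v~p)
      a-isolated (yes b∈F) with y ∈? F
      ... | yes y∈F = inj₂ (inj₂ (inj₂ (inj₂ (inj₁
        (component-++ (component-isolated a∈F no-nbr) (component-edge (dis M) b∈F y∈F B.v~b))))))
      ... | no y∉F = inj₂ (inj₂ (inj₂ (inj₂ (inj₂ (inj₁
        (component-++ (component-isolated a∈F no-nbr) (component-isolated b∈F λ w∈F b~w →
          [ (λ { refl → v∉F w∈F }) , (λ { refl → y∉F w∈F }) ]′ (B.only (sub M w∈F) b~w))))))))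
    split {F} M | no v∉F | no a∉F | no b∉F = ⊥-elim (unaddable M V.v∈U v∉F
        (λ p∈F _ v~p _ → ⊥-elim (no-nbr p∈F v~p)) (λ p∈F _ v~p → ⊥-elim (no-nbr p∈F v~p)))
      where
      no-nbr : ∀ {w} → w ∈ F → ¬ v ~ w
      no-nbr w∈F v~w = [ (λ { refl → a∉F w∈F }) , (λ { refl → b∉F w∈F }) ]′ (V.only (sub M w∈F) v~w)
    split {F} M | no v∉F | no a∉F | yes b∈F with y ∈? F | x ∈? F | x′ ∈? F
    ... | no y∉F | _ | _ = ⊥-elim (unaddable M V.v∈U v∉F
        (λ p∈F q∈F v~p v~q → trans (only-b p∈F v~p) (≡-sym (only-b q∈F v~q)))
        (λ p∈F q∈F v~p p~q → no-nbr q∈F (subst (_~ _) (only-b p∈F v~p) p~q)))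
      where
      only-b : ∀ {p} → p ∈ F → v ~ p → p ≡ b
      only-b p∈F v~p = [ (λ { refl → contradiction p∈F a∉F }) , id ]′ (V.only (sub M p∈F) v~p)
      no-nbr : ∀ {w} → w ∈ F → ¬ b ~ w
      no-nbr w∈F b~w = [ (λ { refl → v∉F w∈F }) , (λ { refl → y∉F w∈F }) ]′ (B.only (sub M w∈F) b~w)
    ... | yes y∈F | no x∉F | _ = ⊥-elim (unaddable M A.v∈U a∉F
        (λ p∈F _ a~p _ → ⊥-elim (no-nbr p∈F a~p)) (λ p∈F _ a~p → ⊥-elim (no-nbr p∈F a~p)))
      where
      no-nbr : ∀ {w} → w ∈ F → ¬ a ~ w
      no-nbr w∈F a~w = [ (λ { refl → v∉F w∈F }) , (λ { refl → x∉F w∈F }) ]′ (A.only (sub M w∈F) a~w)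
    ... | yes y∈F | yes x∈F | no x′∉F = ⊥-elim (unaddable M A.v∈U a∉F
        (λ p∈F q∈F a~p a~q → trans (only-x p∈F a~p) (≡-sym (only-x q∈F a~q)))
        (λ p∈F q∈F a~p p~q → no-nbr q∈F (subst (_~ _) (only-x p∈F a~p) p~q)))
      where
      only-x : ∀ {p} → p ∈ F → a ~ p → p ≡ x
      only-x p∈F a~p = [ (λ { refl → contradiction p∈F v∉F }) , id ]′ (A.only (sub M p∈F) a~p)
      no-nbr : ∀ {w} → w ∈ F → ¬ x ~ w
      no-nbr w∈F x~w = [ (λ { refl → a∉F w∈F }) , (λ { refl → x′∉F w∈F }) ]′ (X.only (sub M w∈F) x~w)
    ... | yes y∈F | yes x∈F | yes x′∈F = inj₂ (inj₂ (inj₂ (inj₂ (inj₂ (inj₂ (b∈F , y∈F , x∈F , x′∈F))))))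

    -- The fixed weights are `α⁻³`, three times `α⁻⁴`, and `α⁻⁵`, for removals of 3, 4 and 5
    -- vertices. Only the patterns weighted `w₅` and `w₇` depend on the length of the cycle.
    combine : ∀ w₅ w₇ → Few U (Component (a ∷ b ∷ y ∷ [])) 10000 (6 ^ ∣ U ∣) w₅ → Few U Far 10000 (6 ^ ∣ U ∣) w₇ →
              Ratio U 10000 (2609 + (1667 + (1667 + (1667 + (w₅ + (1065 + w₇))))))
    combine w₅ w₇ few₅ few₇ = few⇒bound split
      (few-⊎ {w = 2609} (λ _ → id) iso
      (few-⊎ {w = 1667} (λ _ → id) (edge at-v at-a)
      (few-⊎ {w = 1667} (λ _ → id) (edge (twoNbrs-swap at-v) at-b)
      (few-⊎ {w = 1667} (λ _ → id) (edge (twoNbrs-swap at-a) at-x)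
      (few-⊎ {w = w₅} {v = 1065 + w₇} (λ _ → id) few₅
      (few-⊎ {w = 1065} {v = w₇} (λ _ → id) both few₇))))))
      where
      iso : Few U (Component (v ∷ [])) 10000 (6 ^ ∣ U ∣) 2609
      iso = few-component-list small (v ∷ []) (v ∷ a ∷ b ∷ []) (s≤s z≤n)
        ((~⇒≢ V.v~a ∷ ~⇒≢ V.v~b ∷ []) ∷ (V.a≢b ∷ []) ∷ [] ∷ [])
        (V.v∈U ∷ V.a∈U ∷ V.b∈U ∷ [])
        (∈N[]-self {v ∷ []} (here refl) ∷ ∈N[]-nbr {v ∷ []} (here refl) V.v~a ∷ ∈N[]-nbr {v ∷ []} (here refl) V.v~b ∷ [])
        computed
      both : Few U (Component (a ∷ b ∷ [])) 10000 (6 ^ ∣ U ∣) 1065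
      both = few-component-list small I (v ∷ a ∷ b ∷ x ∷ y ∷ []) (s≤s z≤n)
        ((~⇒≢ V.v~a ∷ ~⇒≢ V.v~b ∷ A.a≢b ∷ B.a≢b ∷ []) ∷ (V.a≢b ∷ ~⇒≢ A.v~b ∷ a≢y ∷ []) ∷ (b≢x ∷ ~⇒≢ B.v~b ∷ [])
          ∷ (x≢y ∷ []) ∷ [] ∷ [])
        (V.v∈U ∷ V.a∈U ∷ V.b∈U ∷ X.v∈U ∷ Y.v∈U ∷ [])
        (∈N[]-nbr {I} (here refl) A.v~a ∷ ∈N[]-self {I} (here refl) ∷ ∈N[]-self {I} (there (here refl))
          ∷ ∈N[]-nbr {I} (here refl) A.v~b ∷ ∈N[]-nbr {I} (there (here refl)) B.v~b ∷ [])
        computed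
        where
        I = a ∷ b ∷ []

    -- All five vertices are removed with the pattern `a`, `b`, `y`, and in `Far` the vertex `y`
    -- would have the two neighbours `b` and `x` in `F`. The total is 9740.
    pentagon-strict : x ~ y → Strict U
    pentagon-strict x~y = strict (≤ᵇ⇒≤ _ 10000 tt) (combine 1065 0 few₅ few₇)
      where
      I = a ∷ b ∷ y ∷ []
      few₅ : Few U (Component I) 10000 (6 ^ ∣ U ∣) 1065
      few₅ = few-component-list small I (v ∷ a ∷ b ∷ x ∷ y ∷ []) (s≤s z≤n)
        ((~⇒≢ V.v~a ∷ ~⇒≢ V.v~b ∷ A.a≢b ∷ B.a≢b ∷ []) ∷ (V.a≢b ∷ ~⇒≢ A.v~b ∷ a≢y ∷ []) ∷ (b≢x ∷ ~⇒≢ B.v~b ∷ [])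
          ∷ (x≢y ∷ []) ∷ [] ∷ [])
        (V.v∈U ∷ V.a∈U ∷ V.b∈U ∷ X.v∈U ∷ Y.v∈U ∷ [])
        (∈N[]-nbr {I} (here refl) A.v~a ∷ ∈N[]-self {I} (here refl) ∷ ∈N[]-self {I} (there (here refl))
          ∷ ∈N[]-nbr {I} (here refl) A.v~b ∷ ∈N[]-self {I} (there (there (here refl))) ∷ [])
        computed
      few₇ : Few U Far 10000 (6 ^ ∣ U ∣) 0
      few₇ = few-∅ λ M (b∈F , y∈F , x∈F , _) → b≢x (dis M y∈F b∈F x∈F (~-sym B.v~b) (~-sym x~y))

    -- Now `y′` is a sixth vertex, so the pattern `a`, `b`, `y` costs only `α⁻⁶`, and `Far` costs at
    -- most `α⁻⁷`. The total is 9791.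
    long-cycle-strict : ¬ x ~ y → Strict U
    long-cycle-strict x≁y = strict (≤ᵇ⇒≤ _ 10000 tt) (combine 681 435 few₅ few₇)
      where
      I = a ∷ b ∷ y ∷ []
      J = b ∷ y ∷ x ∷ x′ ∷ []
      v≢x′ : v ≢ x′
      v≢x′ refl = [ (λ { refl → ~-irrefl A.v~b }) , b≢x ∘ ≡-sym ]′ (V.only X.v∈U (~-sym X.v~b))
      v≢y′ : v ≢ y′
      v≢y′ refl = [ a≢y ∘ ≡-sym , (λ { refl → ~-irrefl B.v~b }) ]′ (V.only Y.v∈U (~-sym Y.v~b))
      b≢x′ : b ≢ x′
      b≢x′ refl = [ A.a≢b ∘ ≡-sym , x≢y ]′ (B.only X.v∈U (~-sym X.v~b))
      a≢y′ : a ≢ y′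
      a≢y′ refl = [ B.a≢b ∘ ≡-sym , x≢y ∘ ≡-sym ]′ (A.only Y.v∈U (~-sym Y.v~b))
      x≢y′ : x ≢ y′
      x≢y′ refl = x≁y (~-sym Y.v~b)
      y≢x′ : y ≢ x′
      y≢x′ refl = x≁y X.v~b
      few₅ : Few U (Component I) 10000 (6 ^ ∣ U ∣) 681
      few₅ = few-component-list small I (v ∷ a ∷ b ∷ x ∷ y ∷ y′ ∷ []) (s≤s z≤n)
        ((~⇒≢ V.v~a ∷ ~⇒≢ V.v~b ∷ A.a≢b ∷ B.a≢b ∷ v≢y′ ∷ []) ∷ (V.a≢b ∷ ~⇒≢ A.v~b ∷ a≢y ∷ a≢y′ ∷ [])
          ∷ (b≢x ∷ ~⇒≢ B.v~b ∷ Y.a≢b ∷ []) ∷ (x≢y ∷ x≢y′ ∷ []) ∷ (~⇒≢ Y.v~b ∷ []) ∷ [] ∷ [])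
        (V.v∈U ∷ V.a∈U ∷ V.b∈U ∷ X.v∈U ∷ Y.v∈U ∷ Y.b∈U ∷ [])
        (∈N[]-nbr {I} (here refl) A.v~a ∷ ∈N[]-self {I} (here refl) ∷ ∈N[]-self {I} (there (here refl))
          ∷ ∈N[]-nbr {I} (here refl) A.v~b ∷ ∈N[]-self {I} (there (there (here refl)))
          ∷ ∈N[]-nbr {I} (there (there (here refl))) Y.v~b ∷ [])
        computed
      few₇ : Few U Far 10000 (6 ^ ∣ U ∣) 435
      few₇ with x′ ≟ y′
      -- In a hexagon `y` would have both `b` and `x′` as neighbours in `F`.
      ... | yes refl = few-∅ λ M (b∈F , y∈F , x∈F , x′∈F) → b≢x′ (dis M y∈F b∈F x′∈F Y.v~a Y.v~b)
      ... | no x′≢y′ = few-mono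
        (λ M (b∈F , y∈F , x∈F , x′∈F) →
          component-++ (component-edge (dis M) b∈F y∈F B.v~b) (component-edge (dis M) x∈F x′∈F X.v~b))
        ≤-refl
        (few-component-list small J (v ∷ a ∷ b ∷ x ∷ y ∷ x′ ∷ y′ ∷ []) (s≤s z≤n)
          ((~⇒≢ V.v~a ∷ ~⇒≢ V.v~b ∷ A.a≢b ∷ B.a≢b ∷ v≢x′ ∷ v≢y′ ∷ [])
            ∷ (V.a≢b ∷ ~⇒≢ A.v~b ∷ a≢y ∷ X.a≢b ∷ a≢y′ ∷ [])
            ∷ (b≢x ∷ ~⇒≢ B.v~b ∷ b≢x′ ∷ Y.a≢b ∷ []) ∷ (x≢y ∷ ~⇒≢ X.v~b ∷ x≢y′ ∷ [])
            ∷ (y≢x′ ∷ ~⇒≢ Y.v~b ∷ []) ∷ (x′≢y′ ∷ []) ∷ [] ∷ [])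
          (V.v∈U ∷ V.a∈U ∷ V.b∈U ∷ X.v∈U ∷ Y.v∈U ∷ X.b∈U ∷ Y.b∈U ∷ [])
          (∈N[]-nbr {J} (here refl) B.v~a ∷ ∈N[]-nbr {J} (there (there (here refl))) X.v~a
            ∷ ∈N[]-self {J} (here refl) ∷ ∈N[]-self {J} (there (there (here refl))) ∷ ∈N[]-self {J} (there (here refl))
            ∷ ∈N[]-self {J} (there (there (there (here refl)))) ∷ ∈N[]-nbr {J} (there (here refl)) Y.v~b ∷ [])
          computed)

-- Components isomorphic to C₄

∣p∪q∣≤ : ∀ {n} (p q : Subset n) → ∣ p ∪ q ∣ ≤ ∣ p ∣ + ∣ q ∣
∣p∪q∣≤ p q = begin
  ∣ p ∪ q ∣                             ≡⟨ ∣p∣≡∣p─q∣+∣p∩q∣ (p ∪ q) q ⟩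
  ∣ (p ∪ q) ─ q ∣ + ∣ (p ∪ q) ∩ q ∣     ≤⟨ +-mono-≤ (p⊆q⇒∣p∣≤∣q∣ {p = (p ∪ q) ─ q} {q = p} λ x∈ →
                                             [ id , (λ x∈q → contradiction x∈q (x∉p─q {p = p ∪ q} x∈)) ]′
                                               (x∈p∪q⁻ p q (p─q⊆p (p ∪ q) q x∈)))
                                           (∣p∩q∣≤∣q∣ (p ∪ q) q) ⟩
  ∣ p ∣ + ∣ q ∣                         ∎
  where open ≤-Reasoning

image : ∀ {m n} → (Fin m → Fin n) → Subset m → Subset n
image f [] = ⊥
image f (inside ∷ s) = ⁅ f zero ⁆ ∪ image (f ∘ suc) s
image f (outside ∷ s) = image (f ∘ suc) s

∈-image⁺ : ∀ {m n} (f : Fin m → Fin n) {s k} → k ∈ s → f k ∈ image f s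
∈-image⁺ f {inside ∷ s} here = p⊆p∪q (image (f ∘ suc) s) (x∈⁅x⁆ (f zero))
∈-image⁺ f {inside ∷ s} (there k∈s) = q⊆p∪q ⁅ f zero ⁆ _ (∈-image⁺ (f ∘ suc) k∈s)
∈-image⁺ f {outside ∷ s} (there k∈s) = ∈-image⁺ (f ∘ suc) k∈s

∈-image⁻ : ∀ {m n} (f : Fin m → Fin n) s {x} → x ∈ image f s → ∃ λ k → k ∈ s × x ≡ f k
∈-image⁻ f [] x∈ = contradiction x∈ ∉⊥
∈-image⁻ f (inside ∷ s) x∈ with x∈p∪q⁻ ⁅ f zero ⁆ (image (f ∘ suc) s) x∈
... | inj₁ x∈₀ = zero , here , x∈⁅y⁆⇒x≡y (f zero) x∈₀
... | inj₂ x∈s with ∈-image⁻ (f ∘ suc) s x∈s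
...   | k , k∈s , eq = suc k , there k∈s , eq
∈-image⁻ f (outside ∷ s) x∈ with ∈-image⁻ (f ∘ suc) s x∈
... | k , k∈s , eq = suc k , there k∈s , eq

∣image∣ : ∀ {m n} (f : Fin m → Fin n) → (∀ {j k} → f j ≡ f k → j ≡ k) → ∀ s → ∣ image f s ∣ ≡ ∣ s ∣
∣image∣ {n = n} f inj [] = ∣⊥∣≡0 n
∣image∣ f inj (outside ∷ s) = ∣image∣ (f ∘ suc) (suc-injective ∘ inj) s
∣image∣ f inj (inside ∷ s) = trans (≤-antisym
    (≤-trans (∣p∪q∣≤ ⁅ f zero ⁆ S) (≤-reflexive (cong (_+ ∣ S ∣) (∣⁅x⁆∣≡1 (f zero)))))
    (≤-trans (≤-reflexive (cong (_+ ∣ S ∣) (≡-sym (∣⁅x⁆∣≡1 (f zero))))) (∣p∣+∣q∣≤ (p⊆p∪q S) (q⊆p∪q ⁅ f zero ⁆ S) disjoint)))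
  (cong suc (∣image∣ (f ∘ suc) (suc-injective ∘ inj) s))
  where
  S = image (f ∘ suc) s
  disjoint : ∀ {x} → x ∈ ⁅ f zero ⁆ → x ∉ S
  disjoint x∈ x∈S with ∈-image⁻ (f ∘ suc) s x∈S
  ... | k , _ , eq with inj (trans (≡-sym (x∈⁅y⁆⇒x≡y (f zero) x∈)) eq)
  ...   | ()

trace : ∀ {m n} → (Fin m → Fin n) → Subset n → Subset m
trace f F = tabulate (lookup F ∘ f)

∈-trace⁺ : ∀ {m n} (f : Fin m → Fin n) {F k} → f k ∈ F → k ∈ trace f F
∈-trace⁺ f {F} {k} fk∈F = lookup⇒[]= k _ (trans (lookup∘tabulate (lookup F ∘ f) k) ([]=⇒lookup fk∈F))

∈-trace⁻ : ∀ {m n} (f : Fin m → Fin n) {F k} → k ∈ trace f F → f k ∈ F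
∈-trace⁻ f {F} {k} k∈ = lookup⇒[]= (f k) F (trans (≡-sym (lookup∘tabulate (lookup F ∘ f) k)) ([]=⇒lookup k∈))

count-family : ∀ {m n c} {P : Pred (Subset n) 0ℓ} (P? : Decidable P) (Q : Fin m → Pred (Subset n) 0ℓ)
               (Q? : ∀ i → Decidable (Q i)) → (∀ {i F} → Q i F → P F) → (∀ {i j F} → Q i F → Q j F → i ≡ j) →
               (∀ i → c ≤ countSubsets (Q? i)) → m * c ≤ countSubsets P?
count-family {zero} P? Q Q? sub dis le = z≤n
count-family {suc m} {c = c} P? Q Q? sub dis le = ≤-trans
  (+-mono-≤ (le zero) (count-family rest? (Q ∘ suc) (Q? ∘ suc) (_ ,_) (λ p q → suc-injective (dis p q)) (le ∘ suc)))
  (count-disjoint P? (Q? zero) rest? (λ F → [ sub , (λ (_ , q) → sub q) ]′)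
    λ F q₀ (i , q) → contradiction (dis q₀ q) λ ())
  where
  rest? : Decidable (λ F → ∃ λ i → Q (suc i) F)
  rest? F = any? λ i → Q? (suc i) F

count-unique : ∀ {n} (S : Subset n) {P : Pred (Subset n) 0ℓ} (P? : Decidable P) → P S → (∀ F → P F → F ≡ S) →
               countSubsets P? ≡ 1
count-unique [] P? p u with P? []
... | yes _ = refl
... | no ¬p = contradiction p ¬p
count-unique (inside ∷ S) P? p u = cong₂ _+_
  (count-unique S (P? ∘ (inside ∷_)) p λ F q → Vec.∷-injectiveʳ (u (inside ∷ F) q))
  (count-∅ (P? ∘ (outside ∷_)) λ F q → contradiction (u (outside ∷ F) q) λ ())
count-unique (outside ∷ S) P? p u = cong₂ _+_
  (count-∅ (P? ∘ (inside ∷_)) λ F q → contradiction (u (inside ∷ F) q) λ ())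
  (count-unique S (P? ∘ (outside ∷_)) p λ F q → Vec.∷-injectiveʳ (u (outside ∷ F) q))

module C₄ = Dissociation (C4s 1)

C₄-dis⇒∣s∣≤2 : ∀ s → C₄.Dis s → ∣ s ∣ ≤ 2
C₄-dis⇒∣s∣≤2 s d = ≮⇒≥ λ lt → toWitnessFalse
  {a? = anySubset? λ s → isDissociation? (C4s 1) s ×-dec (2 <? ∣ s ∣)} tt (s , C₄.dis⇒IsDissociation d , lt)

-- All two-element subsets. In C₄ any two vertices form a dissociation set and no three do, so these
-- are its maximum dissociation sets and the origin of the 6.
pairs : Fin 6 → Subset 4
pairs 0F = inside ∷ inside ∷ outside ∷ outside ∷ []
pairs 1F = inside ∷ outside ∷ inside ∷ outside ∷ []
pairs 2F = inside ∷ outside ∷ outside ∷ inside ∷ []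
pairs 3F = outside ∷ inside ∷ inside ∷ outside ∷ []
pairs 4F = outside ∷ inside ∷ outside ∷ inside ∷ []
pairs 5F = outside ∷ outside ∷ inside ∷ inside ∷ []

∣pairs∣≡2 : ∀ i → ∣ pairs i ∣ ≡ 2
∣pairs∣≡2 = toWitness {a? = all? λ i → ∣ pairs i ∣ ℕ.≟ 2} tt

pairs-injective : ∀ i j → pairs i ≡ pairs j → i ≡ j
pairs-injective = toWitness {a? = all? λ i → all? λ j → ≡-dec Bool._≟_ (pairs i) (pairs j) →-dec (i ≟ j)} tt

pairs-dis : ∀ i → C₄.Dis (pairs i)
pairs-dis i = C₄.IsDissociation⇒dis (toWitness {a? = all? λ i → isDissociation? (C4s 1) (pairs i)} tt i)

∣s∣≡2⇒pair : ∀ s → ∣ s ∣ ≡ 2 → ∃ λ i → s ≡ pairs i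
∣s∣≡2⇒pair s eq with any? (λ i → ≡-dec Bool._≟_ s (pairs i))
... | yes p = p
... | no ¬p = ⊥-elim (toWitnessFalse
  {a? = anySubset? λ s → (∣ s ∣ ℕ.≟ 2) ×-dec ¬? (any? λ i → ≡-dec Bool._≟_ s (pairs i))} tt (s , eq , ¬p))

module SquareComponents {n : ℕ} (G : Graph n) where
  open Dissociation G

  record Square (U : Subset n) (f : Fin 4 → Fin n) : Set where
    field
      mem : ∀ k → f k ∈ U
      inj : ∀ {j k} → f j ≡ f k → j ≡ k
      edges : ∀ j k → adj G (f j) (f k) ≡ adj (C4s 1) j k
      closed : ∀ {k w} → w ∈ U → f k ~ w → ∃ λ j → w ≡ f j

  data Squares : Subset n → ℕ → Set where
    nil : ∀ {U} → (∀ v → v ∉ U) → Squares U 0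
    cons : ∀ {U f k} → Square U f → Squares (U ─ image f ⊤) k → Squares U (suc k)

  module _ {U f} (sq : Square U f) where
    open Square sq

    private
      R : Subset n
      R = image f ⊤

      ∈R : ∀ {k} → f k ∈ R
      ∈R = ∈-image⁺ f ∈⊤

    image-dis : ∀ {s} → C₄.Dis s → Dis (image f s)
    image-dis {s} d v∈ x∈ y∈ v~x v~y with ∈-image⁻ f s v∈ | ∈-image⁻ f s x∈ | ∈-image⁻ f s y∈
    ... | i , i∈s , refl | j , j∈s , refl | k , k∈s , refl =
      cong f (d i∈s j∈s k∈s (trans (≡-sym (edges i j)) v~x) (trans (≡-sym (edges i k)) v~y))

    trace-dis : ∀ {F} → Dis F → C₄.Dis (trace f F)
    trace-dis d {i} {j} {k} i∈ j∈ k∈ i~j i~k =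
      inj (d (∈-trace⁻ f i∈) (∈-trace⁻ f j∈) (∈-trace⁻ f k∈) (trans (edges i j) i~j) (trans (edges i k) i~k))

    extend-⊆ : ∀ {T} s → T ⊆ U ─ R → T ∪ image f s ⊆ U
    extend-⊆ {T} s T⊆ x∈ with x∈p∪q⁻ T (image f s) x∈
    ... | inj₁ x∈T = p─q⊆p U R (T⊆ x∈T)
    ... | inj₂ x∈s with ∈-image⁻ f s x∈s
    ...   | k , _ , refl = mem k

    extend-dis : ∀ {T} s → T ⊆ U ─ R → Dis T → C₄.Dis s → Dis (T ∪ image f s)
    extend-dis s T⊆ dT ds = dis-∪ dT (image-dis ds) no-edge
      where
      no-edge : ∀ {x y} → x ∈ _ → y ∈ image f s → ¬ x ~ y
      no-edge x∈T y∈ x~y with ∈-image⁻ f s y∈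
      ... | k , _ , refl with closed (p─q⊆p U R (T⊆ x∈T)) (~-sym x~y)
      ...   | j , refl = x∉p─q {p = U} (T⊆ x∈T) ∈R

    extend-disjoint : ∀ {T} s → T ⊆ U ─ R → ∀ {x} → x ∈ T → x ∉ image f s
    extend-disjoint s T⊆ x∈T x∈s with ∈-image⁻ f s x∈s
    ... | k , _ , refl = x∉p─q {p = U} (T⊆ x∈T) ∈R

    extend-size : ∀ {T} s → T ⊆ U ─ R → ∣ T ∣ + ∣ s ∣ ≤ ∣ T ∪ image f s ∣
    extend-size {T} s T⊆ = subst (λ z → ∣ T ∣ + z ≤ ∣ T ∪ image f s ∣) (∣image∣ f inj s)
      (∣p∣+∣q∣≤ (p⊆p∪q (image f s)) (q⊆p∪q T (image f s)) (extend-disjoint s T⊆))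

    trace-extend : ∀ {T} s → T ⊆ U ─ R → trace f (T ∪ image f s) ≡ s
    trace-extend {T} s T⊆ = ⊆-antisym to λ k∈s → ∈-trace⁺ f (q⊆p∪q T (image f s) (∈-image⁺ f k∈s))
      where
      to : trace f (T ∪ image f s) ⊆ s
      to k∈ with x∈p∪q⁻ T (image f s) (∈-trace⁻ f k∈)
      ... | inj₁ fk∈T = ⊥-elim (x∉p─q {p = U} (T⊆ fk∈T) ∈R)
      ... | inj₂ fk∈s with ∈-image⁻ f s fk∈s
      ...   | j , j∈s , eq = subst (_∈ s) (≡-sym (inj eq)) j∈s

    ∣F∣≤ : ∀ F → ∣ F ∣ ≤ ∣ F ─ R ∣ + ∣ trace f F ∣
    ∣F∣≤ F = begin
      ∣ F ∣                              ≡⟨ ∣p∣≡∣p─q∣+∣p∩q∣ F R ⟩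
      ∣ F ─ R ∣ + ∣ F ∩ R ∣              ≤⟨ +-monoʳ-≤ ∣ F ─ R ∣ (p⊆q⇒∣p∣≤∣q∣ {p = F ∩ R} {q = image f (trace f F)} ∩⊆) ⟩
      ∣ F ─ R ∣ + ∣ image f (trace f F) ∣ ≡⟨ cong (∣ F ─ R ∣ +_) (∣image∣ f inj (trace f F)) ⟩
      ∣ F ─ R ∣ + ∣ trace f F ∣          ∎
      where
      open ≤-Reasoning
      ∩⊆ : F ∩ R ⊆ image f (trace f F)
      ∩⊆ x∈ with x∈p∩q⁻ F R x∈
      ... | x∈F , x∈R with ∈-image⁻ f ⊤ x∈R
      ...   | k , _ , refl = ∈-image⁺ f (∈-trace⁺ f x∈F)

    ─-⊆ : ∀ {F} → F ⊆ U → F ─ R ⊆ U ─ R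
    ─-⊆ {F} F⊆U x∈ = x∈p∧x∉q⇒x∈p─q (F⊆U (p─q⊆p F R x∈)) (x∉p─q {p = F} x∈)

    -- No more than two vertices fit into a C₄, and fewer are not optimal: the part of `F` inside
    -- the component can be replaced by any pair.
    max-trace : ∀ {F} → MaxIn U F → ∣ trace f F ∣ ≡ 2
    max-trace {F} M = ≤-antisym (C₄-dis⇒∣s∣≤2 _ (trace-dis (dis M))) (+-cancelˡ-≤ (∣ F ─ R ∣) 2 (∣ trace f F ∣) (begin
      ∣ F ─ R ∣ + 2                     ≤⟨ extend-size (pairs 0F) (─-⊆ (sub M)) ⟩
      ∣ (F ─ R) ∪ image f (pairs 0F) ∣  ≤⟨ max M (extend-⊆ (pairs 0F) (─-⊆ (sub M)))
                                            (extend-dis (pairs 0F) (─-⊆ (sub M)) (dis-⊆ (p─q⊆p F R) (dis M)) (pairs-dis 0F)) ⟩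
      ∣ F ∣                             ≤⟨ ∣F∣≤ F ⟩
      ∣ F ─ R ∣ + ∣ trace f F ∣         ∎))
      where open ≤-Reasoning

    extend-max : ∀ {T} i → MaxIn (U ─ R) T → MaxIn U (T ∪ image f (pairs i))
    extend-max {T} i M = maxIn (extend-⊆ (pairs i) (sub M)) (extend-dis (pairs i) (sub M) (dis M) (pairs-dis i))
      λ {F} F⊆U dF → begin
        ∣ F ∣                         ≤⟨ ∣F∣≤ F ⟩
        ∣ F ─ R ∣ + ∣ trace f F ∣     ≤⟨ +-mono-≤ (max M (─-⊆ F⊆U) (dis-⊆ (p─q⊆p F R) dF))
                                          (≤-trans (C₄-dis⇒∣s∣≤2 _ (trace-dis dF)) (≤-reflexive (≡-sym (∣pairs∣≡2 i)))) ⟩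
        ∣ T ∣ + ∣ pairs i ∣           ≤⟨ extend-size (pairs i) (sub M) ⟩
        ∣ T ∪ image f (pairs i) ∣     ∎
      where open ≤-Reasoning

    -- With both `D` and `M` equal to 1 a `Bound` is a plain inequality, so the covering lemmas for
    -- `Few` also give this exact estimate. The patterns are the six pairs inside the component.
    φ-square-≤ : φ U ≤ 6 * φ (U ─ R)
    φ-square-≤ = ^4-cancel-≤ (few⇒bound {A = λ F → ∃ λ i → i ∈ ⊤ × Agrees R (image f (pairs i)) F} cover
        (few-∃-sum {6} {w = φ (U ─ R)} ⊤ (λ i → Agrees R (image f (pairs i))) λ {i} _ →
          few-restrict R (image f (pairs i)) (nbr∈R i) (bound ≤-refl′)))
      where
      ≤-refl′ : (1 * φ (U ─ R)) ^ 4 ≤ φ (U ─ R) ^ 4 * 1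
      ≤-refl′ = ≤-reflexive (trans (cong (_^ 4) (*-identityˡ (φ (U ─ R)))) (≡-sym (*-identityʳ _)))
      ^4-cancel-≤ : ∀ {x y} → Bound 1 1 x y → x ≤ y
      ^4-cancel-≤ {x} {y} (bound p) = ≮⇒≥ λ y<x → <⇒≱ (^-monoˡ-< 4 y<x)
        (≤-trans (≤-reflexive (cong (_^ 4) (≡-sym (*-identityˡ x)))) (≤-trans p (≤-reflexive (*-identityʳ (y ^ 4)))))
      nbr∈R : ∀ i {x w} → x ∈ image f (pairs i) → w ∈ U → x ~ w → w ∈ R
      nbr∈R i x∈ w∈U x~w with ∈-image⁻ f (pairs i) x∈
      ... | k , _ , refl with closed w∈U x~w
      ...   | j , refl = ∈R
      cover : ∀ {F} → MaxIn U F → ∃ λ i → i ∈ ⊤ × Agrees R (image f (pairs i)) F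
      cover {F} M with ∣s∣≡2⇒pair (trace f F) (max-trace M)
      ... | i , eq = i , ∈⊤ , agrees
        where
        agrees : Agrees R (image f (pairs i)) F
        agrees x x∈R with ∈-image⁻ f ⊤ x∈R
        ... | k , _ , refl = mk⇔
          (λ fk∈F → ∈-image⁺ f (subst (k ∈_) eq (∈-trace⁺ f fk∈F)))
          λ fk∈s → let (j , j∈s , fk≡fj) = ∈-image⁻ f (pairs i) fk∈s in
            subst (_∈ F) (≡-sym fk≡fj) (∈-trace⁻ f (subst (j ∈_) (≡-sym eq) j∈s))

    -- Every maximum set outside the component can be completed by each of the six pairs, and the
    -- resulting families are told apart by their trace.
    φ-square-≥ : 6 * φ (U ─ R) ≤ φ U
    φ-square-≥ = count-family (maxIn? U) (λ i F → MaxIn U F × trace f F ≡ pairs i)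
      (λ i F → maxIn? U F ×-dec ≡-dec Bool._≟_ (trace f F) (pairs i)) proj₁
      (λ {i} {j} (_ , p) (_ , q) → pairs-injective i j (trans (≡-sym p) q))
      λ i → count-extend (image f (pairs i)) _ (maxIn? (U ─ R))
        (λ T x M x∈s x∈T → extend-disjoint (pairs i) (sub M) x∈T x∈s)
        (λ T M → extend-max i M , trace-extend (pairs i) (sub M))

    φ-square : φ U ≡ 6 * φ (U ─ R)
    φ-square = ≤-antisym φ-square-≤ φ-square-≥

    ∣square∣ : ∣ U ∣ ≡ 4 + ∣ U ─ R ∣
    ∣square∣ = trans (∣p∣≡∣p─q∣+∣p∩q∣ U R) (trans (+-comm ∣ U ─ R ∣ ∣ U ∩ R ∣) (cong (_+ ∣ U ─ R ∣) (trans
      (cong ∣_∣ (⊆-antisym (p∩q⊆q U R) λ x∈R → x∈p∩q⁺ (R⊆U x∈R , x∈R))) (∣image∣ f inj ⊤))))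
      where
      R⊆U : R ⊆ U
      R⊆U x∈R with ∈-image⁻ f ⊤ x∈R
      ... | k , _ , refl = mem k

  φ-empty : φ ⊥ ≡ 1
  φ-empty = count-unique ⊥ (maxIn? ⊥)
    (maxIn id (λ v∈ → ⊥-elim (∉⊥ v∈)) λ T⊆ _ → p⊆q⇒∣p∣≤∣q∣ T⊆)
    λ F M → ⊆-antisym (sub M) (⊥-elim ∘ ∉⊥)

  φ-squares : ∀ {U k} → Squares U k → φ U ≡ 6 ^ k
  φ-squares (nil empty) = trans (cong φ (Empty-unique λ (v , v∈U) → empty v v∈U)) φ-empty
  φ-squares (cons sq rest) = trans (φ-square sq) (cong (6 *_) (φ-squares rest))

  ∣squares∣ : ∀ {U k} → Squares U k → ∣ U ∣ ≡ 4 * k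
  ∣squares∣ (nil empty) = trans (cong ∣_∣ (Empty-unique λ (v , v∈U) → empty v v∈U)) (∣⊥∣≡0 n)
  ∣squares∣ {k = suc k} (cons sq rest) = trans (∣square∣ sq) (trans (cong (4 +_) (∣squares∣ rest)) (≡-sym (*-suc 4 k)))

-- Numbering the vertices of a union of 4-cycles

-- For every k this is definitionally adj (C4s k) on vertex numbers, whose definition Defs keeps private.
cycleAdj : ℕ → ℕ → Bool
cycleAdj a b = (a / 4 ≡ᵇ b / 4) ∧ (next (a % 4) (b % 4) ∨ next (b % 4) (a % 4))
  where
  next : ℕ → ℕ → Bool
  next x y = (y ≡ᵇ suc x) ∨ ((x ≡ᵇ 3) ∧ (y ≡ᵇ 0))

[4+p]/4 : ∀ p → (4 + p) / 4 ≡ suc (p / 4)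
[4+p]/4 p = m/n≡1+[m∸n]/n {4 + p} {4} (m≤m+n 4 p)

cycleAdj-shift : ∀ p q → cycleAdj (4 + p) (4 + q) ≡ cycleAdj p q
cycleAdj-shift p q rewrite [4+p]/4 p | [4+p]/4 q = refl

cycleAdj-separate : ∀ (j : Fin 4) q → cycleAdj (toℕ j) (4 + q) ≡ false
cycleAdj-separate 0F q rewrite [4+p]/4 q = refl
cycleAdj-separate 1F q rewrite [4+p]/4 q = refl
cycleAdj-separate 2F q rewrite [4+p]/4 q = refl
cycleAdj-separate 3F q rewrite [4+p]/4 q = refl

-- Read off from the `sym` field of a `C4s` large enough to have both numbers as vertices.
cycleAdj-sym : ∀ a b → cycleAdj a b ≡ cycleAdj b a
cycleAdj-sym a b = trans (≡-sym (cong₂ cycleAdj (toℕ-fromℕ< a<) (toℕ-fromℕ< b<)))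
    (trans (sym (C4s (suc (a + b))) (fromℕ< a<) (fromℕ< b<)) (cong₂ cycleAdj (toℕ-fromℕ< b<) (toℕ-fromℕ< a<)))
  where
  a+b< : suc (a + b) ≤ 4 * suc (a + b)
  a+b< = m≤n*m (suc (a + b)) 4
  a< : a < 4 * suc (a + b)
  a< = ≤-trans (s≤s (m≤m+n a b)) a+b<
  b< : b < 4 * suc (a + b)
  b< = ≤-trans (s≤s (m≤n+m b a)) a+b<

module Codings {n : ℕ} (G : Graph n) where
  open Dissociation G
  open SquareComponents G

  -- An isomorphism from `G[U]` to `C4s k`, but with values in `ℕ`, so that splitting off one square
  -- is a shift by 4 without casts between types of the form `Fin (4 * k)`.
  record Coding (U : Subset n) (k : ℕ) (g : Fin n → ℕ) : Set where
    field
      bounded : ∀ {v} → v ∈ U → g v < 4 * k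
      injective : ∀ {u v} → u ∈ U → v ∈ U → g u ≡ g v → u ≡ v
      surjective : ∀ {i} → i < 4 * k → ∃ λ v → v ∈ U × g v ≡ i
      edges : ∀ {u v} → u ∈ U → v ∈ U → adj G u v ≡ cycleAdj (g u) (g v)

  -- The first square takes the numbers 0 to 3 and the code of the remaining vertices is shifted by
  -- 4. Edges between the two parts are absent on both sides, by `closed` and by
  -- `cycleAdj-separate`.
  squares⇒coding : ∀ {U k} → Squares U k → ∃ (Coding U k)
  squares⇒coding (nil empty) = (λ _ → 0) , record
    { bounded = λ {v} v∈U → contradiction v∈U (empty v)
    ; injective = λ {u} u∈U → contradiction u∈U (empty u)
    ; surjective = λ ()
    ; edges = λ {u} u∈U → contradiction u∈U (empty u) }
  squares⇒coding {U} {suc k} (cons {f = f} sq rest) = g , record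
    { bounded = λ {v} v∈U → subst (g v <_) (≡-sym (*-suc 4 k)) (bounded v∈U)
    ; injective = injective ; surjective = λ {i} i< → surjective (subst (i <_) (*-suc 4 k) i<) ; edges = edges }
    where
    module S = Square sq
    g′ : Fin n → ℕ
    g′ = proj₁ (squares⇒coding rest)
    module C = Coding (proj₂ (squares⇒coding rest))
    locate : ∀ w → Dec (∃ λ j → w ≡ f j)
    locate w = any? λ j → w ≟ f j
    code : ∀ w → Dec (∃ λ j → w ≡ f j) → ℕ
    code w (yes (j , _)) = toℕ j
    code w (no _) = 4 + g′ w
    g : Fin n → ℕ
    g w = code w (locate w)
    g-square : ∀ j → g (f j) ≡ toℕ j
    g-square j with locate (f j)
    ... | yes (i , eq) = cong toℕ (S.inj (≡-sym eq))
    ... | no ¬p = contradiction (j , refl) ¬p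
    g-rest : ∀ {w} → w ∈ U ─ image f ⊤ → g w ≡ 4 + g′ w
    g-rest {w} w∈ with locate w
    ... | yes (i , refl) = contradiction (∈-image⁺ f ∈⊤) (x∉p─q {p = U} w∈)
    ... | no _ = refl
    view : ∀ {w} → w ∈ U → (∃ λ j → w ≡ f j) ⊎ w ∈ U ─ image f ⊤
    view {w} w∈U with locate w
    ... | yes p = inj₁ p
    ... | no ¬p = inj₂ (x∈p∧x∉q⇒x∈p─q w∈U λ w∈R →
      let (k , _ , eq) = ∈-image⁻ f ⊤ w∈R in ¬p (k , eq))
    separate : ∀ {j w} → w ∈ U ─ image f ⊤ → adj G (f j) w ≡ false
    separate {j} w∈ = ¬-not λ j~w → let (i , eq) = S.closed (p─q⊆p U (image f ⊤) w∈) j~w in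
      x∉p─q {p = U} w∈ (subst (_∈ image f ⊤) (≡-sym eq) (∈-image⁺ f ∈⊤))
    bounded : ∀ {v} → v ∈ U → g v < 4 + 4 * k
    bounded v∈U with view v∈U
    ... | inj₁ (j , refl) = subst (_< 4 + 4 * k) (≡-sym (g-square j)) (≤-trans (toℕ<n j) (m≤m+n 4 (4 * k)))
    ... | inj₂ v∈ = subst (_< 4 + 4 * k) (≡-sym (g-rest v∈)) (+-monoʳ-< 4 (C.bounded v∈))
    low≢high : ∀ (j : Fin 4) {q} → toℕ j ≢ 4 + q
    low≢high j {q} eq = <⇒≱ (toℕ<n j) (subst (4 ≤_) (≡-sym eq) (m≤m+n 4 q))
    injective : ∀ {u v} → u ∈ U → v ∈ U → g u ≡ g v → u ≡ v
    injective u∈U v∈U eq with view u∈U | view v∈U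
    ... | inj₁ (i , refl) | inj₁ (j , refl) =
      cong f (toℕ-injective (trans (≡-sym (g-square i)) (trans eq (g-square j))))
    ... | inj₁ (i , refl) | inj₂ v∈ = contradiction (trans (≡-sym (g-square i)) (trans eq (g-rest v∈))) (low≢high i)
    ... | inj₂ u∈ | inj₁ (j , refl) = contradiction (trans (≡-sym (g-square j)) (trans (≡-sym eq) (g-rest u∈))) (low≢high j)
    ... | inj₂ u∈ | inj₂ v∈ =
      C.injective u∈ v∈ (+-cancelˡ-≡ 4 _ _ (trans (≡-sym (g-rest u∈)) (trans eq (g-rest v∈))))
    surjective : ∀ {i} → i < 4 + 4 * k → ∃ λ v → v ∈ U × g v ≡ i
    surjective {i} i< with i <? 4
    ... | yes i<4 = f (fromℕ< i<4) , S.mem _ , trans (g-square (fromℕ< i<4)) (toℕ-fromℕ< i<4)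
    ... | no i≮4 with C.surjective {i ∸ 4} (+-cancelˡ-< 4 _ _ (subst (_< 4 + 4 * k) (≡-sym (m+[n∸m]≡n (≮⇒≥ i≮4))) i<))
    ...   | v , v∈ , eq = v , p─q⊆p U (image f ⊤) v∈ , trans (g-rest v∈) (trans (cong (4 +_) eq) (m+[n∸m]≡n (≮⇒≥ i≮4)))
    edges : ∀ {u v} → u ∈ U → v ∈ U → adj G u v ≡ cycleAdj (g u) (g v)
    edges {u} {v} u∈U v∈U with view u∈U | view v∈U
    ... | inj₁ (i , refl) | inj₁ (j , refl) =
      trans (S.edges i j) (≡-sym (cong₂ cycleAdj (g-square i) (g-square j)))
    ... | inj₁ (i , refl) | inj₂ v∈ = trans (separate v∈)
      (≡-sym (trans (cong₂ cycleAdj (g-square i) (g-rest v∈)) (cycleAdj-separate i (g′ v))))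
    ... | inj₂ u∈ | inj₁ (j , refl) = trans (sym G _ _) (trans (separate u∈)
      (≡-sym (trans (cong₂ cycleAdj (g-rest u∈) (g-square j)) (trans (cycleAdj-sym (4 + g′ u) (toℕ j)) (cycleAdj-separate j (g′ u))))))
    ... | inj₂ u∈ | inj₂ v∈ = trans (C.edges u∈ v∈)
      (≡-sym (trans (cong₂ cycleAdj (g-rest u∈) (g-rest v∈)) (cycleAdj-shift (g′ u) (g′ v))))

  -- Conversely, the vertices numbered 0 to 3 form a component, as `cycleAdj` never joins them to
  -- larger numbers, and subtracting 4 numbers the rest.
  coding⇒squares : ∀ k {U g} → Coding U k g → Squares U k
  coding⇒squares zero c = nil λ v v∈U → contradiction (Coding.bounded c v∈U) λ ()
  coding⇒squares (suc k) {U} {g} c = cons square (coding⇒squares k rest)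
    where
    module C = Coding c
    low : ∀ (j : Fin 4) → ∃ λ v → v ∈ U × g v ≡ toℕ j
    low j = C.surjective (≤-trans (toℕ<n j) (subst (4 ≤_) (≡-sym (*-suc 4 k)) (m≤m+n 4 (4 * k))))
    f : Fin 4 → Fin n
    f j = proj₁ (low j)
    f∈U : ∀ j → f j ∈ U
    f∈U j = proj₁ (proj₂ (low j))
    g-f : ∀ j → g (f j) ≡ toℕ j
    g-f j = proj₂ (proj₂ (low j))
    R : Subset n
    R = image f ⊤
    is-low : ∀ {w} → w ∈ U → g w < 4 → ∃ λ j → w ≡ f j
    is-low w∈U lt = fromℕ< lt , C.injective w∈U (f∈U _) (≡-sym (trans (g-f _) (toℕ-fromℕ< lt)))
    square : Square U f
    square = record
      { mem = f∈U
      ; inj = λ {i} {j} eq → toℕ-injective (trans (≡-sym (g-f i)) (trans (cong g eq) (g-f j)))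
      ; edges = λ i j → trans (C.edges (f∈U i) (f∈U j)) (cong₂ cycleAdj (g-f i) (g-f j))
      ; closed = closed }
      where
      closed : ∀ {i w} → w ∈ U → f i ~ w → ∃ λ j → w ≡ f j
      closed {i} {w} w∈U i~w with g w <? 4
      ... | yes lt = is-low w∈U lt
      ... | no ge = contradiction (trans (≡-sym i~w) (trans (C.edges (f∈U i) w∈U)
        (trans (cong₂ cycleAdj (g-f i) (≡-sym (m+[n∸m]≡n (≮⇒≥ ge)))) (cycleAdj-separate i (g w ∸ 4))))) λ ()
    rest∈U : ∀ {w} → w ∈ U ─ R → w ∈ U
    rest∈U = p─q⊆p U R
    high : ∀ {w} → w ∈ U ─ R → 4 + (g w ∸ 4) ≡ g w
    high {w} w∈ = m+[n∸m]≡n (≮⇒≥ λ lt → let (j , eq) = is-low (rest∈U w∈) lt in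
      x∉p─q {p = U} w∈ (subst (_∈ R) (≡-sym eq) (∈-image⁺ f ∈⊤)))
    rest : Coding (U ─ R) k (λ w → g w ∸ 4)
    rest = record
      { bounded = λ w∈ → +-cancelˡ-< 4 _ _ (subst₂ _<_ (≡-sym (high w∈)) (*-suc 4 k) (C.bounded (rest∈U w∈)))
      ; injective = λ u∈ v∈ eq → C.injective (rest∈U u∈) (rest∈U v∈)
          (trans (≡-sym (high u∈)) (trans (cong (4 +_) eq) (high v∈)))
      ; surjective = surjective
      ; edges = λ {u} {v} u∈ v∈ → trans (C.edges (rest∈U u∈) (rest∈U v∈))
          (trans (≡-sym (cong₂ cycleAdj (high u∈) (high v∈))) (cycleAdj-shift (g u ∸ 4) (g v ∸ 4))) }
      where
      surjective : ∀ {i} → i < 4 * k → ∃ λ v → v ∈ U ─ R × g v ∸ 4 ≡ i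
      surjective {i} i< with C.surjective {4 + i} (subst (4 + i <_) (≡-sym (*-suc 4 k)) (+-monoʳ-< 4 i<))
      ... | v , v∈U , eq = v , x∈p∧x∉q⇒x∈p─q v∈U not-low , cong (_∸ 4) eq
        where
        not-low : v ∉ R
        not-low v∈R with ∈-image⁻ f ⊤ v∈R
        ... | j , _ , refl = <⇒≱ (toℕ<n j) (subst (4 ≤_) (trans (≡-sym eq) (g-f j)) (m≤m+n 4 i))

  coding⇒iso : ∀ {k g} → Coding ⊤ k g → G ≅ C4s k
  coding⇒iso {k} {g} c = mk⤖ (injective , surjective) , λ u v →
      trans (C.edges ∈⊤ ∈⊤) (≡-sym (cong₂ cycleAdj (toℕ-fromℕ< (C.bounded ∈⊤)) (toℕ-fromℕ< (C.bounded ∈⊤))))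
    where
    module C = Coding c
    to : Fin n → Fin (4 * k)
    to v = fromℕ< (C.bounded {v} ∈⊤)
    injective : ∀ {u v} → to u ≡ to v → u ≡ v
    injective {u} {v} eq = C.injective ∈⊤ ∈⊤ (fromℕ<-injective _ _ (C.bounded {u} ∈⊤) (C.bounded {v} ∈⊤) eq)
    surjective : ∀ y → ∃ λ x → ∀ {z} → z ≡ x → to z ≡ y
    surjective y with C.surjective (toℕ<n y)
    ... | x , _ , eq = x , λ { refl → toℕ-injective (trans (toℕ-fromℕ< (C.bounded ∈⊤)) eq) }

  iso⇒coding : ∀ {k} → G ≅ C4s k → ∃ (Coding ⊤ k)
  iso⇒coding {k} (f , edges) = toℕ ∘ Bijection.to f , record
    { bounded = λ _ → toℕ<n _
    ; injective = λ _ _ eq → Bijection.injective f (toℕ-injective eq)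
    ; surjective = λ i< → let (x , hit) = Bijection.surjective f (fromℕ< i<) in
        x , ∈⊤ , trans (cong toℕ (hit refl)) (toℕ-fromℕ< i<)
    ; edges = λ {u} {v} _ _ → edges u v }

-- The extremal graphs

scaled-strict : ∀ a .{{_ : NonZero a}} x m → x ^ 4 < a ^ m → (a * x) ^ 4 < a ^ (4 + m)
scaled-strict a x m lt = begin-strict
    (a * x) ^ 4      ≡⟨ ^4-distrib-* a x ⟩
    a ^ 4 * x ^ 4    <⟨ *-monoʳ-< (a ^ 4) {{m^n≢0 a 4}} lt ⟩
    a ^ 4 * a ^ m    ≡⟨ ^-distribˡ-+-* a 4 m ⟨
    a ^ (4 + m)      ∎
  where open ≤-Reasoning

module Extremal {n : ℕ} (G : Graph n) (tf : TriangleFree G) where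
  open Dissociation G
  open Branching G tf
  open Leaves G tf
  open DegreeCases G tf
  open TwoRegular G tf
  open SquareComponents G

  -- The walks from `v` through `a` and through `b` meet again at `x`. Triangle-freeness excludes
  -- both chords, and degree 2 at each of the four vertices leaves no edge to the outside.
  four-cycle : ∀ {U v a b x} → TwoNbrs U v a b → TwoNbrs U a v x → TwoNbrs U b v x → deg U x ≡ 2 → ∃ (Square U)
  four-cycle {U} {v} {a} {b} {x} at-v at-a at-b dx = f , record { mem = mem ; inj = inj _ _ ; edges = edges ; closed = closed _ }
    where
    module V = TwoNbrs at-v
    module A = TwoNbrs at-a
    module B = TwoNbrs at-b
    at-x : ∃ (TwoNbrs U x a)
    at-x = second-nbr A.b∈U dx A.v∈U (~-sym A.v~b)
    module X = TwoNbrs (proj₂ at-x)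
    f : Fin 4 → Fin n
    f 0F = v
    f 1F = a
    f 2F = x
    f 3F = b
    mem : ∀ k → f k ∈ U
    mem 0F = V.v∈U
    mem 1F = A.v∈U
    mem 2F = X.v∈U
    mem 3F = B.v∈U
    v≁x : ¬ v ~ x
    v≁x v~x = no-triangle V.v~a A.v~b v~x
    a≁b : ¬ a ~ b
    a≁b a~b = no-triangle V.v~a a~b V.v~b
    edges : ∀ j k → adj G (f j) (f k) ≡ adj (C4s 1) j k
    edges 0F 0F = irrefl G v
    edges 0F 1F = V.v~a
    edges 0F 2F = ¬-not v≁x
    edges 0F 3F = V.v~b
    edges 1F 0F = ~-sym V.v~a
    edges 1F 1F = irrefl G a
    edges 1F 2F = A.v~b
    edges 1F 3F = ¬-not a≁b
    edges 2F 0F = ¬-not (v≁x ∘ ~-sym)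
    edges 2F 1F = ~-sym A.v~b
    edges 2F 2F = irrefl G x
    edges 2F 3F = ~-sym B.v~b
    edges 3F 0F = ~-sym V.v~b
    edges 3F 1F = ¬-not (a≁b ∘ ~-sym)
    edges 3F 2F = B.v~b
    edges 3F 3F = irrefl G b
    inj : ∀ j k → f j ≡ f k → j ≡ k
    inj 0F 0F _ = refl
    inj 0F 1F eq = contradiction eq (~⇒≢ V.v~a)
    inj 0F 2F eq = contradiction eq A.a≢b
    inj 0F 3F eq = contradiction eq (~⇒≢ V.v~b)
    inj 1F 0F eq = contradiction (≡-sym eq) (~⇒≢ V.v~a)
    inj 1F 1F _ = refl
    inj 1F 2F eq = contradiction eq (~⇒≢ A.v~b)
    inj 1F 3F eq = contradiction eq V.a≢b
    inj 2F 0F eq = contradiction (≡-sym eq) A.a≢b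
    inj 2F 1F eq = contradiction (≡-sym eq) (~⇒≢ A.v~b)
    inj 2F 2F _ = refl
    inj 2F 3F eq = contradiction (≡-sym eq) (~⇒≢ B.v~b)
    inj 3F 0F eq = contradiction (≡-sym eq) (~⇒≢ V.v~b)
    inj 3F 1F eq = contradiction (≡-sym eq) V.a≢b
    inj 3F 2F eq = contradiction eq (~⇒≢ B.v~b)
    inj 3F 3F _ = refl
    closed : ∀ k {w} → w ∈ U → f k ~ w → ∃ λ j → w ≡ f j
    closed 0F w∈U v~w = [ (1F ,_) , (3F ,_) ]′ (V.only w∈U v~w)
    closed 1F w∈U a~w = [ (0F ,_) , (2F ,_) ]′ (A.only w∈U a~w)
    -- `at-x` knows only `a` and some second neighbour of `x`; since `b` is a neighbour of `x` other
    -- than `a`, it is that one.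
    closed 2F w∈U x~w with X.only w∈U x~w | X.only B.v∈U (~-sym B.v~b)
    ... | inj₁ w≡a | _ = 1F , w≡a
    ... | inj₂ _ | inj₁ b≡a = contradiction (≡-sym b≡a) V.a≢b
    ... | inj₂ w≡z | inj₂ b≡z = 3F , trans w≡z (≡-sym b≡z)
    closed 3F w∈U b~w = [ (0F ,_) , (2F ,_) ]′ (B.only w∈U b~w)

  two-regular : ∀ {U v} → Small U → (∀ {u} → u ∈ U → deg U u ≡ 2) → v ∈ U → Strict U ⊎ ∃ (Square U)
  two-regular {U} {v} small d≡2 v∈U with ∣p∣≡suc⇒pick {p = N U v} (d≡2 v∈U)
  ... | a , a∈N , _ with second-nbr v∈U (d≡2 v∈U) (∈N⇒∈ U a∈N) (∈N⇒~ U a∈N)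
  ...   | b , at-v with second-nbr V.a∈U (d≡2 V.a∈U) v∈U (~-sym V.v~a) | second-nbr V.b∈U (d≡2 V.b∈U) v∈U (~-sym V.v~b)
    where module V = TwoNbrs at-v
  ...     | x , at-a | y , at-b with x ≟ y
  ...       | yes refl = inj₂ (four-cycle at-v at-a at-b (d≡2 (TwoNbrs.b∈U at-a)))
  ...       | no x≢y with second-nbr A.b∈U (d≡2 A.b∈U) A.v∈U (~-sym A.v~b) | second-nbr B.b∈U (d≡2 B.b∈U) B.v∈U (~-sym B.v~b)
    where
    module A = TwoNbrs at-a
    module B = TwoNbrs at-b
  ...         | x′ , at-x | y′ , at-y with x ~? y
  ...           | yes x~y = inj₁ (Path.pentagon-strict small at-v at-a at-b at-x at-y x≢y x~y)
  ...           | no x≁y = inj₁ (Path.long-cycle-strict small at-v at-a at-b at-x at-y x≢y x≁y)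

  -- The order of the cases matters: once degrees 0 and 1 are excluded, neighbours have degree at
  -- least 2, as the branchings at high degree require; once degrees from 4 on are excluded too,
  -- only 2 and 3 remain.
  square-or-strict : ∀ U → Small U → Nonempty U → Strict U ⊎ ∃ (Square U)
  square-or-strict U small (v₀ , v₀∈U)
    with any? (λ v → (v ∈? U) ×-dec (deg U v ≤? 1))
  ... | yes (v , v∈U , d≤1) with deg U v in eq | d≤1
  ...   | 0 | _ = inj₁ (isolated-strict small v∈U eq)
  ...   | 1 | _ = inj₁ (leaf-strict small v∈U eq)
  ...   | suc (suc _) | s≤s ()
  square-or-strict U small (v₀ , v₀∈U) | no ¬≤1 with any? (λ v → (v ∈? U) ×-dec (4 ≤? deg U v))
  ... | yes (v , v∈U , 4≤d) = inj₁ (high-degree (deg U v ℕ.≟ 4))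
    where
    2≤nbr : ∀ {u} → u ∈ N U v → 2 ≤ deg U u
    2≤nbr u∈N = ≰⇒> λ d≤1 → ¬≤1 (_ , ∈N⇒∈ U u∈N , d≤1)
    high-degree : Dec (deg U v ≡ 4) → Strict U
    high-degree (yes d≡4) = deg4-strict small v∈U d≡4 2≤nbr
    high-degree (no d≢4) = deg≥5-strict small v∈U (deg U v) refl (≤∧≢⇒< 4≤d (d≢4 ∘ ≡-sym)) 2≤nbr
  ... | no ¬≥4 = low-degree
      (any? λ v → (v ∈? U) ×-dec (deg U v ℕ.≟ 3) ×-dec any? λ a → (a ∈? N U v) ×-dec (deg U a ℕ.≟ 2))
      (any? λ v → (v ∈? U) ×-dec (deg U v ℕ.≟ 3))
    where
    2or3 : ∀ {u} → u ∈ U → deg U u ≡ 2 ⊎ deg U u ≡ 3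
    2or3 {u} u∈U with deg U u in eq
    ... | 0 = contradiction (u , u∈U , ≤-trans (≤-reflexive eq) z≤n) ¬≤1
    ... | 1 = contradiction (u , u∈U , ≤-reflexive eq) ¬≤1
    ... | 2 = inj₁ refl
    ... | 3 = inj₂ refl
    ... | suc (suc (suc (suc d))) = contradiction (u , u∈U , ≤-trans (s≤s (s≤s (s≤s (s≤s z≤n)))) (≤-reflexive (≡-sym eq))) ¬≥4
    low-degree : Dec (∃ λ v → v ∈ U × deg U v ≡ 3 × ∃ λ a → a ∈ N U v × deg U a ≡ 2) →
                 Dec (∃ λ v → v ∈ U × deg U v ≡ 3) → Strict U ⊎ ∃ (Square U)
    low-degree (yes (v , v∈U , dv , a , a∈N , da)) _ = inj₁ (deg3-deg2-strict small v∈U a∈N dv da 2or3)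
    low-degree (no ¬32) (yes (v , v∈U , dv)) with ∣p∣≡suc⇒pick {p = N U v} dv
    -- No vertex of degree 3 has a neighbour of degree 2, so degree 3 passes along edges.
    ... | a , a∈N , _ = inj₁ (cubic-strict small v∈U a∈N dv λ u∈U w∈N du →
      [ (λ dw → contradiction (_ , u∈U , du , _ , w∈N , dw) ¬32) , id ]′ (2or3 (∈N⇒∈ U w∈N)))
    low-degree (no _) (no ¬3) = two-regular small
      (λ u∈U → [ id , (λ du → contradiction (_ , u∈U , du) ¬3) ]′ (2or3 u∈U)) v₀∈U

  squares⇒≡ : ∀ {U k} → Squares U k → φ U ^ 4 ≡ 6 ^ ∣ U ∣
  squares⇒≡ {U} {k} s = trans (cong (_^ 4) (φ-squares s)) (trans (^-*-assoc 6 k 4)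
    (cong (6 ^_) (trans (*-comm k 4) (≡-sym (∣squares∣ s)))))

  -- Proving the dichotomy rather than the inequality settles the equality case in the same
  -- induction. Either alternative for the smaller sets yields the weak bound that `Small` asks for,
  -- and a strict inequality survives the factor 6 of a further C₄.
  strict-or-squares : ∀ U → Strict U ⊎ ∃ (Squares U)
  strict-or-squares U = go U (<-wellFounded ∣ U ∣)
    where
    go : ∀ U → Acc _<_ ∣ U ∣ → Strict U ⊎ ∃ (Squares U)
    go U (acc rs) = step (nonempty? U)
      where
      small : Small U
      small U′ lt = bound (≤-trans (≤-reflexive (cong (_^ 4) (*-identityˡ (φ U′))))
        (≤-trans ([ <⇒≤ , (λ (_ , s) → ≤-reflexive (squares⇒≡ s)) ]′ (go U′ (rs lt))) (≤-reflexive (≡-sym (*-identityˡ (6 ^ ∣ U′ ∣))))))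
      peel : ∀ {f} → Square U f → Strict U ⊎ ∃ (Squares U)
      peel {f} sq with go (U ─ image f ⊤) (rs (≤-trans (s≤s (m≤n+m _ 3)) (≤-reflexive (≡-sym (∣square∣ sq)))))
      ... | inj₂ (k , s) = inj₂ (suc k , cons sq s)
      ... | inj₁ lt = inj₁ (subst₂ (λ x m → x ^ 4 < 6 ^ m) (≡-sym (φ-square sq)) (≡-sym (∣square∣ sq))
        (scaled-strict 6 (φ (U ─ image f ⊤)) (∣ U ─ image f ⊤ ∣) lt))
      step : Dec (Nonempty U) → Strict U ⊎ ∃ (Squares U)
      step (no empty) = inj₂ (0 , nil λ v v∈U → empty (v , v∈U))
      step (yes ne) = [ inj₁ , peel ∘ proj₂ ]′ (square-or-strict U small ne)

  φ′≡φ⊤ : φ′ G ≡ φ ⊤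
  φ′≡φ⊤ = ≤-antisym
    (count-mono (isMaxDissociation? G) (maxIn? ⊤) λ F (d , m) →
      maxIn (λ _ → ∈⊤) (IsDissociation⇒dis d) λ {T} _ dT → m T (dis⇒IsDissociation dT))
    (count-mono (maxIn? ⊤) (isMaxDissociation? G) λ F M →
      dis⇒IsDissociation (dis M) , λ T dT → max M (λ _ → ∈⊤) (IsDissociation⇒dis dT))

theorem1p4 : ∀ (n : ℕ) (G : Graph n) → TriangleFree G →
    (φ′ G ^ 4 ≤ 6 ^ n)
    × ((φ′ G ^ 4 ≡ 6 ^ n) ⇔ Σ ℕ (λ k → (n ≡ 4 * k) × (G ≅ C4s k)))
theorem1p4 n G tf = upper , mk⇔ extremal⇒iso iso⇒extremal
  where
  open Dissociation G
  open SquareComponents G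
  open Codings G
  open Extremal G tf
  upper : φ′ G ^ 4 ≤ 6 ^ n
  upper rewrite φ′≡φ⊤ = subst (λ m → φ ⊤ ^ 4 ≤ 6 ^ m) (∣⊤∣≡n n)
    ([ <⇒≤ , (λ (_ , s) → ≤-reflexive (squares⇒≡ s)) ]′ (strict-or-squares ⊤))
  extremal⇒iso : φ′ G ^ 4 ≡ 6 ^ n → Σ ℕ (λ k → (n ≡ 4 * k) × (G ≅ C4s k))
  extremal⇒iso eq rewrite φ′≡φ⊤ with strict-or-squares ⊤
  ... | inj₁ lt = contradiction (trans eq (cong (6 ^_) (≡-sym (∣⊤∣≡n n)))) (<⇒≢ lt)
  ... | inj₂ (k , s) = k , trans (≡-sym (∣⊤∣≡n n)) (∣squares∣ s) , coding⇒iso (proj₂ (squares⇒coding s))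
  iso⇒extremal : Σ ℕ (λ k → (n ≡ 4 * k) × (G ≅ C4s k)) → φ′ G ^ 4 ≡ 6 ^ n
  iso⇒extremal (k , _ , iso) rewrite φ′≡φ⊤ =
    trans (squares⇒≡ (coding⇒squares k (proj₂ (iso⇒coding iso)))) (cong (6 ^_) (∣⊤∣≡n n))
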